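{- Let $\Sigma$ be an alphabet and $(\mathcal{O},d)$ a pseudometric space. The functor $H=V\circ K:\mathbf{HS}_{\Sigma}\to\mathbf{Tr}_{\Sigma\times\mathbb{R}_{\ge0}}\mathcal{O}$ is a coreflection, and the unit and counit of this adjunction are $0$-bounded morphisms.
   Context: A hybrid system is a tuple $(M,I,(n_i)_{i\in I},E,(G_e)_{e\in E},(R_{e,i})_{e\in E,i\in I},(F_{m,i})_{m\in M,i\in I},(I_m)_{m\in M},m_0,\sigma_0,o)$ where $M$ is a set of modes, $I$ a set of subsystems, $n_i\in\mathbb{N}$, $E\subseteq M\times\Sigma\times M$ a set of events, $G_e\subseteq\prod_{i\in I}\mathbb{R}^{n_i}$ guards, $R_{e,i}:\mathbb{R}^{n_i}\to\mathbb{R}^{n_i}$ reset functions, $F_{m,i}:\mathbb{R}\times\mathbb{R}^{n_i}\to\mathbb{R}^{n_i}$ continuous flow functions that are locally Lipschitz in the second argument, $I_m\subseteq\prod_{i}\mathbb{R}^{n_i}$ invariants, $m_0\in M$, $\sigma_0=(\sigma_{i,0})_i\in\prod_i\mathbb{R}^{n_i}$, and $o:M\times\prod_i\mathbb{R}^{n_i}\to\mathcal{O}$. The system moves from configuration $(m,\sigma)$ to $(m',\sigma')$ doing action $a$ with time $t\ge0$ if $e=(m,a,m')\in E$ and for every $i\in I$ there is a differentiable $x_i:[0,t]\to\mathbb{R}^{n_i}$ with $\dot x_i(s)=F_{m,i}(s,x_i(s))$ and $(x_i(s))_i\in I_m$ for all $s\in[0,t]$, $(x_i(0))_i=\sigma$,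 $(x_i(t))_i\in G_e$, and $\sigma'=(R_{e,i}(x_i(t)))_i$. A run is a sequence $(m_0,\sigma_0)\xrightarrow{a_1,t_1}\cdots\xrightarrow{a_k,t_k}(m_k,\sigma_k)$ of such moves starting at the initial configuration. An $\epsilon$-bounded morphism $T\to T'$ is a pair $(f_M,f_I)$ with $f_M:M\to M'$, $f_I:I'\to I$ such that: $f_M(m_0)=m'_0$; $(m,a,m')\in E$ implies $f_E(m,a,m'):=(f_M(m),a,f_M(m'))\in E'$; for all $i'\in I'$, $n_{i'}=n_{f_I(i')}$, $F_{m,f_I(i')}=F'_{f_M(m),i'}$ for all $m$, and $R_{e,f_I(i')}=R'_{f_E(e),i'}$ for all $e$; writing $f_X((x_i)_{i\in I})=(x_{f_I(i')})_{i'\in I'}$, one has $f_X(\sigma_0)=\sigma'_0$, $\sigma\in I_m\Rightarrow f_X(\sigma)\in I'_{f_M(m)}$, $\sigma\in G_e\Rightarrow f_X(\sigma)\in G'_{f_E(e)}$; and for every run ending in $(m_k,\sigma_k)$, $d(o(m_k,\sigma_k),o'(f_M(m_k),f_X(\sigma_k)))\le\epsilon$. Bounded morphisms (those $\epsilon$-bounded for some $\epsilon\ge0$) with composition $(g_M,g_I)\circ(f_M,f_I)=(g_M\circ f_M,f_I\circ g_I)$ form the category $\mathbf{HS}_{\Sigma}$. For an alphabet $A$, a transition system with observations is $(S,i,\Delta,\omega)$ with $\Delta\subseteq S\times A\times S$, $\omega:S\to\mathcal{O}$; an $\epsilon$-bounded morphism is a function on states preserving the initial state and transitions with $d(\omega(s),\omega'(f(s)))\le\epsilon$;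 bounded morphisms form $\mathbf{TS}_{A}\mathcal{O}$, and $\mathbf{Tr}_{A}\mathcal{O}$ is its full subcategory of systems whose underlying transition system is a synchronization tree (every state reached by exactly one run from the initial state). $K:\mathbf{HS}_{\Sigma}\to\mathbf{TS}_{\Sigma\times\mathbb{R}_{\ge0}}\mathcal{O}$ sends $T$ to the system whose states are configurations $(m,\sigma)\in M\times\prod_i\mathbb{R}^{n_i}$, initial state $(m_0,\sigma_0)$, transitions $((m,\sigma),(a,t),(m',\sigma'))$ whenever $T$ moves from $(m,\sigma)$ to $(m',\sigma')$ doing $a$ with time $t$, and observation $o$; on morphisms $K(f_M,f_I)(m,\sigma)=(f_M(m),f_X(\sigma))$. $V:\mathbf{TS}_{A}\mathcal{O}\to\mathbf{Tr}_{A}\mathcal{O}$ sends a system to the tree of its runs (initial state the one-element run, transitions extending a run by one transition) with observation of a run equal to the observation of its last state, acting pointwise on morphisms. A functor is a coreflection if it is a right adjoint whose left adjoint is fully faithful (equivalently, a right adjoint whose unit is a natural isomorphism).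
   Formalization: Bounded morphisms of transition systems are required to satisfy the distance bound only on states reached by runs, because with the bound on all states K would not send bounded morphisms to bounded ones; on synchronization trees, and so for H, this changes nothing. -}

module Defs where

open import Algebra.Structures using (IsCommutativeRing)
import Algebra.Construct.NaturalChoice.Max as Max
open import Axiom.ExcludedMiddle using (ExcludedMiddle)
open import Axiom.Extensionality.Propositional using (Extensionality)
open import Data.Fin.Base using (Fin)
open import Data.Irrelevant using (Irrelevant; [_])
open import Data.Nat.Base using (ℕ)
open import Data.Nat.Properties using (≡-irrelevant)
open import Data.Product using (∃; ∃!; _×_; _,_; proj₁; proj₂)
open import Data.Refinement using (Refinement-syntax; value; _,_)
open import Data.Vec.Functional using (Vector; foldr; map; zipWith)
open import Function.Base using (id; _∘_)
open import Function.Definitions using (Bijective)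
open import Level using (Level; 0ℓ; suc; _⊔_)
open import Relation.Binary using (Rel; IsEquivalence; IsTotalOrder; TotalOrder)
open import Relation.Binary.PropositionalEquality
  using (_≡_; _≢_; refl; sym; trans; cong; cong₂; subst; subst-subst)
open import Relation.Nullary.Decidable.Core using (recompute)
open import Relation.Unary using (Pred)

------------------------------------------------------------------------
-- Category theory

record Category (o h e : Level) : Set (suc (o ⊔ h ⊔ e)) where
  infix  4 _≈_
  infixr 9 _∙_
  field
    Obj       : Set o
    Hom       : Obj → Obj → Set h
    _≈_       : ∀ {A B} → Rel (Hom A B) e
    identity  : ∀ {A} → Hom A A
    _∙_       : ∀ {A B C} → Hom B C → Hom A B → Hom A C
    equiv     : ∀ {A B} → IsEquivalence (_≈_ {A} {B})
    ∙-cong    : ∀ {A B C} {g g′ : Hom B C} {f f′ : Hom A B} →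
                g ≈ g′ → f ≈ f′ → g ∙ f ≈ g′ ∙ f′
    identityˡ : ∀ {A B} {f : Hom A B} → identity ∙ f ≈ f
    identityʳ : ∀ {A B} {f : Hom A B} → f ∙ identity ≈ f
    assoc     : ∀ {A B C D} {h : Hom C D} {g : Hom B C} {f : Hom A B} →
                (h ∙ g) ∙ f ≈ h ∙ (g ∙ f)

module _ {o h e o′ h′ e′} (C : Category o h e) (D : Category o′ h′ e′) where
  private
    module C = Category C
    module D = Category D

  record Functor : Set (o ⊔ h ⊔ e ⊔ o′ ⊔ h′ ⊔ e′) where
    field
      F₀       : C.Obj → D.Obj
      F₁       : ∀ {A B} → C.Hom A B → D.Hom (F₀ A) (F₀ B)
      F-cong   : ∀ {A B} {f g : C.Hom A B} → f C.≈ g → F₁ f D.≈ F₁ g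
      F-id     : ∀ {A} → F₁ (C.identity {A}) D.≈ D.identity
      F-∙      : ∀ {A B X} {g : C.Hom B X} {f : C.Hom A B} →
                 F₁ (g C.∙ f) D.≈ F₁ g D.∙ F₁ f

module _ {o h e o′ h′ e′} {C : Category o h e} {D : Category o′ h′ e′} where
  private
    module C = Category C
    module D = Category D

  FullyFaithful : Functor C D → Set (o ⊔ h ⊔ e ⊔ h′ ⊔ e′)
  FullyFaithful F = ∀ A B → Bijective C._≈_ D._≈_ (F₁ {A} {B})
    where open Functor F

  record Adjunction (L : Functor C D) (R : Functor D C)
                    : Set (o ⊔ h ⊔ e ⊔ o′ ⊔ h′ ⊔ e′) where
    private
      module L = Functor L
      module R = Functor R
    field
      unit           : ∀ A → C.Hom A (R.F₀ (L.F₀ A))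
      unit-natural   : ∀ {A B} (f : C.Hom A B) →
                       unit B C.∙ f C.≈ R.F₁ (L.F₁ f) C.∙ unit A
      counit         : ∀ X → D.Hom (L.F₀ (R.F₀ X)) X
      counit-natural : ∀ {X Y} (g : D.Hom X Y) →
                       counit Y D.∙ L.F₁ (R.F₁ g) D.≈ g D.∙ counit X
      triangleˡ      : ∀ A → counit (L.F₀ A) D.∙ L.F₁ (unit A) D.≈ D.identity
      triangleʳ      : ∀ X → R.F₁ (counit X) C.∙ unit (R.F₀ X) C.≈ C.identity

module _ {o h e o′ h′ e′} {C : Category o h e} {D : Category o′ h′ e′} where

  record Coreflection (R : Functor D C) : Set (o ⊔ h ⊔ e ⊔ o′ ⊔ h′ ⊔ e′) where
    field
      left          : Functor C D
      adjunction    : Adjunction left R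
      fullyFaithful : FullyFaithful left
    open Adjunction adjunction public

_∘F_ : ∀ {o h e o′ h′ e′ o″ h″ e″}
       {A : Category o h e} {B : Category o′ h′ e′} {C : Category o″ h″ e″} →
       Functor B C → Functor A B → Functor A C
_∘F_ {C = C} G F = record
  { F₀     = G.F₀ ∘ F.F₀
  ; F₁     = G.F₁ ∘ F.F₁
  ; F-cong = G.F-cong ∘ F.F-cong
  ; F-id   = C.trans (G.F-cong F.F-id) G.F-id
  ; F-∙    = C.trans (G.F-cong F.F-∙) G.F-∙
  }
  where
  module F = Functor F
  module G = Functor G
  module C {X Y} = IsEquivalence (Category.equiv C {X} {Y})

------------------------------------------------------------------------
-- Real numbers

-- The real numbers are characterised up to isomorphism as a
-- (Dedekind-)complete ordered field.

record CompleteOrderedField : Set₁ where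
  infix  4 _≤_ _<_
  infixl 6 _+_ _-_
  infixl 7 _*_
  field
    ℝ                 : Set
    _+_ _*_           : ℝ → ℝ → ℝ
    -_                : ℝ → ℝ
    0# 1#             : ℝ
    _≤_               : Rel ℝ 0ℓ
    isCommutativeRing : IsCommutativeRing _≡_ _+_ _*_ -_ 0# 1#
    0≢1               : 0# ≢ 1#
    inverse           : ∀ x → x ≢ 0# → ∃ λ y → x * y ≡ 1#
    isTotalOrder      : IsTotalOrder _≡_ _≤_
    +-monoˡ-≤         : ∀ z {x y} → x ≤ y → x + z ≤ y + z
    *-nonNegative     : ∀ {x y} → 0# ≤ x → 0# ≤ y → 0# ≤ x * y

  UpperBound : Pred ℝ 0ℓ → Pred ℝ 0ℓ
  UpperBound P b = ∀ x → P x → x ≤ b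

  field
    supremum : (P : Pred ℝ 0ℓ) → ∃ P → ∃ (UpperBound P) →
               ∃ λ s → UpperBound P s × (∀ b → UpperBound P b → s ≤ b)

  open IsCommutativeRing isCommutativeRing public
    using (+-comm; +-identityˡ; +-identityʳ)
  open IsTotalOrder isTotalOrder public
    using () renaming (refl to ≤-refl; trans to ≤-trans; reflexive to ≤-reflexive)

  totalOrder : TotalOrder 0ℓ 0ℓ 0ℓ
  totalOrder = record { isTotalOrder = isTotalOrder }

  open Max totalOrder public using () renaming (_⊔_ to max)

  _<_ : Rel ℝ 0ℓ
  x < y = x ≤ y × x ≢ y

  _-_ : ℝ → ℝ → ℝ
  x - y = x + (- y)

  ∣_∣ : ℝ → ℝ
  ∣ x ∣ = max x (- x)

  +-mono-≤ : ∀ {w x y z} → w ≤ x → y ≤ z → w + y ≤ x + z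
  +-mono-≤ {w} {x} {y} {z} w≤x y≤z =
    ≤-trans (+-monoˡ-≤ y w≤x)
      (≤-trans (≤-reflexive (+-comm x y))
        (≤-trans (+-monoˡ-≤ x y≤z) (≤-reflexive (+-comm z x))))

  ℝ≥0 : Set
  ℝ≥0 = [ t ∈ ℝ ∣ 0# ≤ t ]

record PseudometricSpace (R : CompleteOrderedField) : Set₁ where
  open CompleteOrderedField R
  field
    Point       : Set
    d           : Point → Point → ℝ
    nonNegative : ∀ x y → 0# ≤ d x y
    d-refl      : ∀ x → d x x ≡ 0#
    d-sym       : ∀ x y → d x y ≡ d y x
    triangle    : ∀ x y z → d x z ≤ d x y + d y z

------------------------------------------------------------------------
-- Elementary analysis in ℝⁿ

module Analysis (R : CompleteOrderedField) where
  open CompleteOrderedField R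

  infix 8 ℝ^_

  ℝ^_ : ℕ → Set
  ℝ^ n = Vector ℝ n

  infixl 6 _⊖_
  infixl 7 _⊙_

  _⊖_ : ∀ {n} → ℝ^ n → ℝ^ n → ℝ^ n
  _⊖_ = zipWith _-_

  _⊙_ : ∀ {n} → ℝ → ℝ^ n → ℝ^ n
  c ⊙ x = map (c *_) x

  -- All norms on ℝⁿ being equivalent, the choice of the maximum norm is
  -- immaterial in the notions defined from it below.
  ‖_‖ : ∀ {n} → ℝ^ n → ℝ
  ‖ x ‖ = foldr max 0# (map ∣_∣ x)

  Continuous : ∀ {n} → (ℝ → ℝ^ n → ℝ^ n) → Set
  Continuous F =
    ∀ s x ε → 0# < ε → ∃ λ δ → 0# < δ ×
      (∀ s′ x′ → ∣ s′ - s ∣ < δ → ‖ x′ ⊖ x ‖ < δ → ‖ F s′ x′ ⊖ F s x ‖ < ε)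

  -- The Lipschitz constant is uniform in the first argument, locally, as
  -- in the Picard–Lindelöf theorem.
  LocallyLipschitz₂ : ∀ {n} → (ℝ → ℝ^ n → ℝ^ n) → Set
  LocallyLipschitz₂ F =
    ∀ s x → ∃ λ δ → 0# < δ × ∃ λ L →
      (∀ s′ y z → ∣ s′ - s ∣ < δ → ‖ y ⊖ x ‖ < δ → ‖ z ⊖ x ‖ < δ →
        ‖ F s′ y ⊖ F s′ z ‖ ≤ L * ‖ y ⊖ z ‖)

  [0,_] : ℝ≥0 → Set
  [0, t ] = [ s ∈ ℝ ∣ 0# ≤ s × s ≤ value t ]

  left-end : ∀ t → [0, t ]
  left-end (_ , [ 0≤t ]) = 0# , [ ≤-refl , 0≤t ]

  right-end : ∀ t → [0, t ]
  right-end (t , [ 0≤t ]) = t , [ 0≤t , ≤-refl ]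

  -- x is differentiable at s with derivative v (one-sidedly at the end
  -- points of the interval).
  HasDerivative : ∀ {n} t → ([0, t ] → ℝ^ n) → [0, t ] → ℝ^ n → Set
  HasDerivative t x s v =
    ∀ ε → 0# < ε → ∃ λ δ → 0# < δ ×
      (∀ u → ∣ value u - value s ∣ < δ →
        ‖ (x u ⊖ x s) ⊖ (value u - value s) ⊙ v ‖ ≤ ε * ∣ value u - value s ∣)

  cast : ∀ {m n} → m ≡ n → ℝ^ m → ℝ^ n
  cast = subst ℝ^_

  cast-hasDerivative : ∀ {m n} (m≡n : m ≡ n) t (x : [0, t ] → ℝ^ m) s v →
                       HasDerivative t x s v →
                       HasDerivative t (cast m≡n ∘ x) s (cast m≡n v)
  cast-hasDerivative refl t x s v x′ = x′

------------------------------------------------------------------------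
-- The categories and functors under study, in a classical metatheory

-- Classical logic is made explicit by assuming excluded middle and
-- function extensionality. A subset of X is a predicate X → Set. Data
-- depend on membership proofs only irrelevantly, so that, for instance,
-- runs are determined by their states and actions.

module HybridSystems
  (em  : ExcludedMiddle 0ℓ)
  (ext : Extensionality 0ℓ 0ℓ)
  (R   : CompleteOrderedField)
  (O   : PseudometricSpace R)
  where

  open CompleteOrderedField R
  open Analysis R
  open PseudometricSpace O renaming (Point to 𝒪)

  private
    d-∘ : ∀ {x y z ε ε′} → d x y ≤ ε → d y z ≤ ε′ → d x z ≤ ε + ε′
    d-∘ p q = ≤-trans (triangle _ _ _) (+-mono-≤ p q)

    0≤+ : ∀ {x y} → 0# ≤ x → 0# ≤ y → 0# ≤ x + y
    0≤+ p q = ≤-trans (≤-reflexive (sym (+-identityˡ 0#))) (+-mono-≤ p q)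

  ----------------------------------------------------------------------
  -- Transition systems with observations

  record TransitionSystem (A : Set) : Set₁ where
    field
      State : Set
      init  : State
      Δ     : State → A → State → Set
      ω     : State → 𝒪

  module _ {A : Set} (T : TransitionSystem A) where
    open TransitionSystem T

    data Run : Set
    last : Run → State

    data Run where
      start  : Run
      extend : (r : Run) (a : A) (s : State) → .(Δ (last r) a s) → Run

    last start            = init
    last (extend _ _ s _) = s

    IsSynchronizationTree : Set
    IsSynchronizationTree = ∀ s → ∃! _≡_ λ r → last r ≡ s

  module _ {A : Set} where

    record TSMorphism (T T′ : TransitionSystem A) : Set where
      private
        module T  = TransitionSystem T
        module T′ = TransitionSystem T′
      field
        fun    : T.State → T′.State
        pres-i : fun T.init ≡ T′.init
        pres-Δ : ∀ {s a s′} → T.Δ s a s′ → T′.Δ (fun s) a (fun s′)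

    -- The observations are compared on the states reached by runs, as
    -- for hybrid systems; otherwise K would not preserve boundedness. In a
    -- synchronization tree these are all states, see tree-bounded.
    _-BoundedTS_ : ∀ {T T′} → ℝ → TSMorphism T T′ → Set
    _-BoundedTS_ {T} {T′} ε f =
      ∀ (r : Run T) → d (T.ω (last T r)) (T′.ω (fun (last T r))) ≤ ε
      where
      module T  = TransitionSystem T
      module T′ = TransitionSystem T′
      open TSMorphism f

    tree-bounded : ∀ {T T′ ε} {f : TSMorphism T T′} →
                   IsSynchronizationTree T → ε -BoundedTS f →
                   ∀ s → d (TransitionSystem.ω T s)
                           (TransitionSystem.ω T′ (TSMorphism.fun f s)) ≤ ε
    tree-bounded tree b s with tree s
    ... | r , refl , _ = b r

    record BoundedTSMorphism (T T′ : TransitionSystem A) : Set where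
      field
        morphism : TSMorphism T T′
        bounded  : ∃ λ ε → 0# ≤ ε × ε -BoundedTS morphism
      open TSMorphism morphism public

    idTS : ∀ {T} → TSMorphism T T
    idTS = record { fun = id ; pres-i = refl ; pres-Δ = id }

    _∙TS_ : ∀ {T T′ T″} → TSMorphism T′ T″ → TSMorphism T T′ → TSMorphism T T″
    g ∙TS f = record
      { fun    = g.fun ∘ f.fun
      ; pres-i = trans (cong g.fun f.pres-i) g.pres-i
      ; pres-Δ = g.pres-Δ ∘ f.pres-Δ
      }
      where
      module f = TSMorphism f
      module g = TSMorphism g

    module _ {T T′ : TransitionSystem A} (f : TSMorphism T T′) where
      open TSMorphism f
      open TransitionSystem T′ using (Δ)

      mapRun      : Run T → Run T′
      last-mapRun : ∀ r → last T′ (mapRun r) ≡ fun (last T r)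

      mapRun start            = start
      mapRun (extend r a s δ) =
        extend (mapRun r) a (fun s)
          (subst (λ z → Δ z a (fun s)) (sym (last-mapRun r)) (pres-Δ δ))

      last-mapRun start            = sym pres-i
      last-mapRun (extend _ _ _ _) = refl

    idTS-bounded : ∀ {T} → 0# -BoundedTS (idTS {T})
    idTS-bounded r = ≤-reflexive (d-refl _)

    ∙TS-bounded : ∀ {T T′ T″ ε ε′} (g : TSMorphism T′ T″) (f : TSMorphism T T′) →
                  ε′ -BoundedTS g → ε -BoundedTS f → (ε + ε′) -BoundedTS (g ∙TS f)
    ∙TS-bounded {T} {T′} {T″} {ε′ = ε′} g f bg bf r =
      d-∘ (bf r) (subst (λ z → d (T′.ω z) (T″.ω (TSMorphism.fun g z)) ≤ ε′)
                        (last-mapRun f r) (bg (mapRun f r)))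
      where
      module T′ = TransitionSystem T′
      module T″ = TransitionSystem T″

    extend-cong : ∀ {T : TransitionSystem A} {r r′ a s s′}
                  .{δ  : TransitionSystem.Δ T (last T r) a s}
                  .{δ′ : TransitionSystem.Δ T (last T r′) a s′} →
                  r ≡ r′ → s ≡ s′ → extend {T = T} r a s δ ≡ extend r′ a s′ δ′
    extend-cong refl refl = refl

  TS : Set → Category (suc 0ℓ) 0ℓ 0ℓ
  TS A = record
    { Obj       = TransitionSystem A
    ; Hom       = BoundedTSMorphism
    ; _≈_       = λ f g → ∀ s → fun f s ≡ fun g s
    ; identity  = record
        { morphism = idTS
        ; bounded  = 0# , ≤-refl , idTS-bounded
        }
    ; _∙_       = λ g f → record
        { morphism = morphism g ∙TS morphism f
        ; bounded  = let ε  , 0≤ε  , bf = bounded f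
                         ε′ , 0≤ε′ , bg = bounded g
                     in  ε + ε′ , 0≤+ 0≤ε 0≤ε′
                       , ∙TS-bounded (morphism g) (morphism f) bg bf
        }
    ; equiv     = record
        { refl  = λ _ → refl
        ; sym   = λ p s → sym (p s)
        ; trans = λ p q s → trans (p s) (q s)
        }
    ; ∙-cong    = λ {_} {_} {_} {g} {_} {_} {f′} p q s →
                    trans (cong (fun g) (q s)) (p (fun f′ s))
    ; identityˡ = λ _ → refl
    ; identityʳ = λ _ → refl
    ; assoc     = λ _ → refl
    }
    where open BoundedTSMorphism

  Tr : Set → Category (suc 0ℓ) 0ℓ 0ℓ
  Tr A = record
    { Obj       = ∃ IsSynchronizationTree
    ; Hom       = λ (T , _) (T′ , _) → Hom T T′
    ; _≈_       = _≈_
    ; identity  = identity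
    ; _∙_       = _∙_
    ; equiv     = equiv
    ; ∙-cong    = λ {_} {_} {_} {g} {g′} {f} {f′} → ∙-cong {g = g} {g′} {f} {f′}
    ; identityˡ = λ {_} {_} {f} → identityˡ {f = f}
    ; identityʳ = λ {_} {_} {f} → identityʳ {f = f}
    ; assoc     = λ {_} {_} {_} {_} {h} {g} {f} → assoc {h = h} {g} {f}
    }
    where open Category (TS A)

  ----------------------------------------------------------------------
  -- Unravelling into trees of runs

  module _ {A : Set} where

    data Extends (T : TransitionSystem A) : Run T → A → Run T → Set where
      extends : ∀ {r a s} .(δ : TransitionSystem.Δ T (last T r) a s) →
                Extends T r a (extend r a s δ)

    unravelling : TransitionSystem A → TransitionSystem A
    unravelling T = record
      { State = Run T
      ; init  = start
      ; Δ     = Extends T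
      ; ω     = TransitionSystem.ω T ∘ last T
      }

    module _ (T : TransitionSystem A) where

      unravelRun      : Run T → Run (unravelling T)
      last-unravelRun : ∀ r → last (unravelling T) (unravelRun r) ≡ r

      unravelRun start              = start
      unravelRun r⁺@(extend r a s δ) =
        extend (unravelRun r) a r⁺
          (subst (λ z → Extends T z a r⁺) (sym (last-unravelRun r)) (extends δ))

      last-unravelRun start            = refl
      last-unravelRun (extend _ _ _ _) = refl

      unravelRun-last : ∀ r̂ → unravelRun (last (unravelling T) r̂) ≡ r̂
      unravelRun-last start             = refl
      unravelRun-last (extend r̂ a r⁺ δ) = aux (recompute em δ) (unravelRun-last r̂)
        where
        aux : ∀ {r̂ a r⁺} (δ : Extends T (last (unravelling T) r̂) a r⁺) →
              unravelRun (last (unravelling T) r̂) ≡ r̂ →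
              unravelRun r⁺ ≡ extend r̂ a r⁺ δ
        aux (extends _) p = extend-cong p refl

      unravelling-isTree : IsSynchronizationTree (unravelling T)
      unravelling-isTree r = unravelRun r , last-unravelRun r , unique
        where
        unique : ∀ {r̂} → last (unravelling T) r̂ ≡ r → unravelRun r ≡ r̂
        unique {r̂} refl = unravelRun-last r̂

    unravelMorphism : ∀ {T T′} → TSMorphism T T′ →
                      TSMorphism (unravelling T) (unravelling T′)
    unravelMorphism f = record
      { fun    = mapRun f
      ; pres-i = refl
      ; pres-Δ = λ where (extends _) → extends _
      }

  V : ∀ {A} → Functor (TS A) (Tr A)
  V = record
    { F₀     = λ T → unravelling T , unravelling-isTree T
    ; F₁     = λ {T} {T′} f → record
        { morphism = unravelMorphism (morphism f)
        ; bounded  = let ε , 0≤ε , b = bounded f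
                     in  ε , 0≤ε , unravel-bounded (morphism f) b
        }
    ; F-cong = λ {_} {_} {f} {g} → map-cong (morphism f) (morphism g)
    ; F-id   = map-id
    ; F-∙    = λ {_} {_} {_} {g} {f} → map-∙ (morphism g) (morphism f)
    }
    where
    open BoundedTSMorphism using (morphism; bounded)
    open TSMorphism

    unravel-bounded : ∀ {A} {T T′ : TransitionSystem A} {ε} (f : TSMorphism T T′) →
                     ε -BoundedTS f → ε -BoundedTS unravelMorphism f
    unravel-bounded {T = T} {T′} {ε} f b r̂ =
      subst (λ z → d (TransitionSystem.ω T (last T r)) (TransitionSystem.ω T′ z) ≤ ε)
            (sym (last-mapRun f r)) (b r)
      where r = last (unravelling T) r̂

    map-cong : ∀ {A} {T T′ : TransitionSystem A} (f g : TSMorphism T T′) →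
               (∀ s → fun f s ≡ fun g s) → ∀ r → mapRun f r ≡ mapRun g r
    map-cong f g f≗g start            = refl
    map-cong f g f≗g (extend r a s _) = extend-cong (map-cong f g f≗g r) (f≗g s)

    map-id : ∀ {A} {T : TransitionSystem A} (r : Run T) → mapRun idTS r ≡ r
    map-id start            = refl
    map-id (extend r _ _ _) = extend-cong (map-id r) refl

    map-∙ : ∀ {A} {T T′ T″ : TransitionSystem A}
            (g : TSMorphism T′ T″) (f : TSMorphism T T′) →
            ∀ r → mapRun (g ∙TS f) r ≡ mapRun g (mapRun f r)
    map-∙ g f start            = refl
    map-∙ g f (extend r _ _ _) = extend-cong (map-∙ g f r) refl

  ----------------------------------------------------------------------
  -- Hybrid systems

  module _ (Σ : Set) where

    record HybridSystem : Set₁ where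
      field
        Mode      : Set
        Subsystem : Set
        dim       : Subsystem → ℕ
        Event     : Mode → Σ → Mode → Set

      Valuation : Set
      Valuation = ∀ i → ℝ^ (dim i)

      field
        Guard          : ∀ {m a m′} → .(Event m a m′) → Pred Valuation 0ℓ
        reset          : ∀ {m a m′} → .(Event m a m′) →
                         ∀ i → ℝ^ (dim i) → ℝ^ (dim i)
        flow           : Mode → ∀ i → ℝ → ℝ^ (dim i) → ℝ^ (dim i)
        flow-cont      : ∀ m i → Continuous (flow m i)
        flow-lipschitz : ∀ m i → LocallyLipschitz₂ (flow m i)
        Invariant      : Mode → Pred Valuation 0ℓ
        m₀             : Mode
        σ₀             : Valuation
        obs            : Mode × Valuation → 𝒪

      Configuration : Set
      Configuration = Mode × Valuation

      record Move (c : Configuration) (l : Σ × ℝ≥0) (c′ : Configuration) : Set where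
        private
          m  = proj₁ c
          σ  = proj₂ c
          m′ = proj₁ c′
          σ′ = proj₂ c′
          a  = proj₁ l
          t  = proj₂ l
        field
          event     : Event m a m′
          x         : ∀ i → [0, t ] → ℝ^ (dim i)
          solution  : ∀ i s → HasDerivative t (x i) s (flow m i (value s) (x i s))
          invariant : ∀ s → Invariant m (λ i → x i s)
          initially : ∀ i → x i (left-end t) ≡ σ i
          finally   : Guard event (λ i → x i (right-end t))
          jump      : ∀ i → σ′ i ≡ reset event i (x i (right-end t))

    configurations : HybridSystem → TransitionSystem (Σ × ℝ≥0)
    configurations T = record
      { State = Configuration
      ; init  = m₀ , σ₀
      ; Δ     = Move
      ; ω     = obs
      }
      where open HybridSystem T

    record HSMorphism (T T′ : HybridSystem) : Set where
      private
        module T  = HybridSystem T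
        module T′ = HybridSystem T′
      field
        f-M       : T.Mode → T′.Mode
        f-I       : T′.Subsystem → T.Subsystem
        pres-m₀   : f-M T.m₀ ≡ T′.m₀
        pres-E    : ∀ {m a m′} → T.Event m a m′ → T′.Event (f-M m) a (f-M m′)
        pres-dim  : ∀ i′ → T.dim (f-I i′) ≡ T′.dim i′
        pres-flow : ∀ m i′ s x → cast (pres-dim i′) (T.flow m (f-I i′) s x)
                                 ≡ T′.flow (f-M m) i′ s (cast (pres-dim i′) x)
        pres-R    : ∀ {m a m′} (e : T.Event m a m′) i′ x →
                    cast (pres-dim i′) (T.reset e (f-I i′) x)
                    ≡ T′.reset (pres-E e) i′ (cast (pres-dim i′) x)

      f-X : T.Valuation → T′.Valuation
      f-X σ i′ = cast (pres-dim i′) (σ (f-I i′))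

      field
        pres-σ₀  : ∀ i′ → f-X T.σ₀ i′ ≡ T′.σ₀ i′
        pres-Inv : ∀ {m σ} → T.Invariant m σ → T′.Invariant (f-M m) (f-X σ)
        pres-G   : ∀ {m a m′} (e : T.Event m a m′) {σ} →
                   T.Guard e σ → T′.Guard (pres-E e) (f-X σ)

      f-C : T.Configuration → T′.Configuration
      f-C (m , σ) = f-M m , f-X σ

    _-BoundedHS_ : ∀ {T T′} → ℝ → HSMorphism T T′ → Set
    _-BoundedHS_ {T} {T′} ε f =
      ∀ (r : Run (configurations T)) →
        let c = last (configurations T) r in d (T.obs c) (T′.obs (f-C c)) ≤ ε
      where
      module T  = HybridSystem T
      module T′ = HybridSystem T′
      open HSMorphism f

    record BoundedHSMorphism (T T′ : HybridSystem) : Set where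
      field
        morphism : HSMorphism T T′
        bounded  : ∃ λ ε → 0# ≤ ε × ε -BoundedHS morphism
      open HSMorphism morphism public

    K-morphism : ∀ {T T′} → HSMorphism T T′ →
                 TSMorphism (configurations T) (configurations T′)
    K-morphism {T} {T′} f = record
      { fun    = f-C
      ; pres-i = cong₂ _,_ pres-m₀ (ext pres-σ₀)
      ; pres-Δ = λ {(m , _)} {(_ , t)} μ → let open HybridSystem.Move μ in record
          { event     = pres-E event
          ; x         = λ i′ s → cast (pres-dim i′) (x (f-I i′) s)
          ; solution  = λ i′ s →
              subst (HasDerivative t (λ u → cast (pres-dim i′) (x (f-I i′) u)) s)
                    (pres-flow m i′ (value s) (x (f-I i′) s))
                    (cast-hasDerivative (pres-dim i′) t (x (f-I i′)) s
                      (HybridSystem.flow T m (f-I i′) (value s) (x (f-I i′) s))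
                      (solution (f-I i′) s))
          ; invariant = λ s → pres-Inv (invariant s)
          ; initially = λ i′ → cong (cast (pres-dim i′)) (initially (f-I i′))
          ; finally   = pres-G event finally
          ; jump      = λ i′ → trans (cong (cast (pres-dim i′)) (jump (f-I i′)))
                                     (pres-R event i′ _)
          }
      }
      where open HSMorphism f

    idHS : ∀ {T} → HSMorphism T T
    idHS = record
      { f-M       = id
      ; f-I       = id
      ; pres-m₀   = refl
      ; pres-E    = id
      ; pres-dim  = λ _ → refl
      ; pres-flow = λ _ _ _ _ → refl
      ; pres-R    = λ _ _ _ → refl
      ; pres-σ₀   = λ _ → refl
      ; pres-Inv  = id
      ; pres-G    = λ _ → id
      }

    module _ {T T′ T″} (g : HSMorphism T′ T″) (f : HSMorphism T T′) where
      private
        module f  = HSMorphism f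
        module g  = HSMorphism g
        module T  = HybridSystem T
        module T″ = HybridSystem T″

        pres-dim : ∀ i″ → T.dim (f.f-I (g.f-I i″)) ≡ T″.dim i″
        pres-dim i″ = trans (f.pres-dim (g.f-I i″)) (g.pres-dim i″)

        cast² : ∀ i″ x → cast (g.pres-dim i″) (cast (f.pres-dim (g.f-I i″)) x)
                         ≡ cast (pres-dim i″) x
        cast² i″ x = subst-subst (f.pres-dim (g.f-I i″)) {g.pres-dim i″} {x}

        f-X² : ∀ σ → g.f-X (f.f-X σ) ≡ λ i″ → cast (pres-dim i″) (σ (f.f-I (g.f-I i″)))
        f-X² σ = ext λ i″ → cast² i″ _

        square : ∀ i″ {x y z w} →
                 cast (f.pres-dim (g.f-I i″)) x ≡ y →
                 cast (g.pres-dim i″) y ≡ w (cast (g.pres-dim i″) (cast (f.pres-dim (g.f-I i″)) z)) →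
                 cast (pres-dim i″) x ≡ w (cast (pres-dim i″) z)
        square i″ {w = w} p q =
          trans (sym (cast² i″ _))
            (trans (cong (cast (g.pres-dim i″)) p) (trans q (cong w (cast² i″ _))))

      _∙HS_ : HSMorphism T T″
      _∙HS_ = record
        { f-M       = g.f-M ∘ f.f-M
        ; f-I       = f.f-I ∘ g.f-I
        ; pres-m₀   = trans (cong g.f-M f.pres-m₀) g.pres-m₀
        ; pres-E    = g.pres-E ∘ f.pres-E
        ; pres-dim  = pres-dim
        ; pres-flow = λ m i″ s x →
            square i″ {w = T″.flow (g.f-M (f.f-M m)) i″ s}
              (f.pres-flow m (g.f-I i″) s x) (g.pres-flow (f.f-M m) i″ s _)
        ; pres-R    = λ e i″ x →
            square i″ {w = T″.reset (g.pres-E (f.pres-E e)) i″}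
              (f.pres-R e (g.f-I i″) x) (g.pres-R (f.pres-E e) i″ _)
        ; pres-σ₀   = λ i″ →
            trans (sym (cast² i″ _))
              (trans (cong (cast (g.pres-dim i″)) (f.pres-σ₀ (g.f-I i″))) (g.pres-σ₀ i″))
        ; pres-Inv  = λ {m} {σ} p →
            subst (T″.Invariant (g.f-M (f.f-M m))) (f-X² σ) (g.pres-Inv (f.pres-Inv p))
        ; pres-G    = λ e {σ} p →
            subst (T″.Guard (g.pres-E (f.pres-E e))) (f-X² σ)
                  (g.pres-G (f.pres-E e) (f.pres-G e p))
        }

      ∙HS-f-C : ∀ c → HSMorphism.f-C _∙HS_ c ≡ g.f-C (f.f-C c)
      ∙HS-f-C (m , σ) = cong (g.f-M (f.f-M m) ,_) (sym (f-X² σ))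

      ∙HS-bounded : ∀ {ε ε′} → ε′ -BoundedHS g → ε -BoundedHS f →
                    (ε + ε′) -BoundedHS _∙HS_
      ∙HS-bounded {ε} {ε′} bg bf r =
        subst (λ z → d (T.obs c) (T″.obs z) ≤ ε + ε′) (sym (∙HS-f-C c))
          (∙TS-bounded (K-morphism g) (K-morphism f) bg bf r)
        where c = last (configurations T) r

    HS : Category (suc 0ℓ) 0ℓ 0ℓ
    HS = record
      { Obj       = HybridSystem
      ; Hom       = BoundedHSMorphism
      ; _≈_       = λ f g → (∀ m → f-M f m ≡ f-M g m) × (∀ i → f-I f i ≡ f-I g i)
      ; identity  = record
          { morphism = idHS
          ; bounded  = 0# , ≤-refl , λ _ → ≤-reflexive (d-refl _)
          }
      ; _∙_       = λ g f → record
          { morphism = morphism g ∙HS morphism f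
          ; bounded  = let ε  , 0≤ε  , bf = bounded f
                           ε′ , 0≤ε′ , bg = bounded g
                       in  ε + ε′ , 0≤+ 0≤ε 0≤ε′
                         , ∙HS-bounded (morphism g) (morphism f) bg bf
          }
      ; equiv     = record
          { refl  = (λ _ → refl) , (λ _ → refl)
          ; sym   = λ (p , q) → (λ m → sym (p m)) , (λ i → sym (q i))
          ; trans = λ (p , q) (p′ , q′) →
              (λ m → trans (p m) (p′ m)) , (λ i → trans (q i) (q′ i))
          }
      ; ∙-cong    = λ {_} {_} {_} {g} {g′} {f} {f′} (p , q) (p′ , q′) →
            (λ m → trans (cong (f-M g) (p′ m)) (p (f-M f′ m)))
          , (λ i → trans (cong (f-I f) (q i)) (q′ (f-I g′ i)))
      ; identityˡ = (λ _ → refl) , (λ _ → refl)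
      ; identityʳ = (λ _ → refl) , (λ _ → refl)
      ; assoc     = (λ _ → refl) , (λ _ → refl)
      }
      where open BoundedHSMorphism

    K : Functor HS (TS (Σ × ℝ≥0))
    K = record
      { F₀     = configurations
      ; F₁     = λ f → record
          { morphism = K-morphism (morphism f)
          ; bounded  = bounded f
          }
      ; F-cong = λ {_} {_} {f} {g} (p , q) (m , σ) →
          cong₂ _,_ (p m) (ext λ i → cast-σ σ (q i) (pres-dim f i) (pres-dim g i))
      ; F-id   = λ _ → refl
      ; F-∙    = λ {_} {_} {_} {g} {f} → ∙HS-f-C (morphism g) (morphism f)
      }
      where
      open BoundedHSMorphism

      cast-σ : ∀ {I : Set} {n : I → ℕ} {k} (σ : ∀ i → ℝ^ (n i)) {i j} → i ≡ j →
               (p : n i ≡ k) (q : n j ≡ k) → cast p (σ i) ≡ cast q (σ j)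
      cast-σ σ refl p q = cong (λ r → cast r (σ _)) (≡-irrelevant p q)

    H : Functor HS (Tr (Σ × ℝ≥0))
    H = V ∘F K

{-# OPTIONS --safe #-}
module Submission where

-- The left adjoint sends a tree S to the hybrid system whose modes are the
-- states of S and whose subsystems are all possible ones: every choice of a
-- dimension, flows, resets and trajectories along the edges of S that fit
-- together. A guard admits only the end points of the chosen trajectories,
-- an invariant only their points. A morphism from this system to T is then
-- determined by its effect on modes and canonical valuations, since each
-- subsystem of T has to be sent to the subsystem of S that it induces; here
-- uniqueness of the solutions of Lipschitz differential equations ensures
-- that the trajectories carry no information beyond the other data. One of
-- the subsystems is a clock, which forces each jump to take exactly the time
-- prescribed by S, so that the runs of the free system are those of S and
-- the unit is invertible.

open import Defs
open import Algebra.Bundles using (CommutativeRing; RawRing)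
import Algebra.Construct.NaturalChoice.Max as Max
import Algebra.Construct.NaturalChoice.MaxOp as MaxOp
import Algebra.Construct.NaturalChoice.Min as Min
import Algebra.Construct.NaturalChoice.MinOp as MinOp
import Algebra.Properties.AbelianGroup as AbelianGroupProperties
import Algebra.Properties.CommutativeSemigroup as CommutativeSemigroupProperties
import Algebra.Properties.Ring as RingProperties
import Algebra.Properties.Semiring.Mult.TCOptimised as Multiples
import Algebra.Solver.Ring as RingSolver
open import Algebra.Solver.Ring.AlmostCommutativeRing
  using (fromCommutativeRing; _-Raw-AlmostCommutative⟶_; Induced-equivalence)
open import Axiom.ExcludedMiddle using (ExcludedMiddle)
open import Axiom.Extensionality.Propositional using (Extensionality)
open import Data.Empty using (⊥-elim)
open import Data.Fin.Base using (zero; suc)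
open import Data.Irrelevant using (Irrelevant; [_])
open import Data.Maybe.Base using (just; nothing)
open import Data.Nat.Base as ℕ using (ℕ)
import Data.Nat.Properties as ℕ
open import Data.Product using (Σ-syntax; ∃; _×_; _,_; proj₁; proj₂)
open import Data.Refinement using (Refinement-syntax; value; _,_)
open import Data.Refinement.Properties using (value-injective)
open import Data.Sum.Base using (_⊎_; inj₁; inj₂)
open import Function.Base using (id; _∘_)
open import Level using (0ℓ; _⊔_)
open import Relation.Binary
  using (IsEquivalence; IsTotalOrder; Rel; Setoid; TotalOrder; Transitive; WeaklyDecidable)
import Relation.Binary.Construct.NonStrictToStrict as Strict
open import Relation.Binary.PropositionalEquality
  using (_≡_; refl; sym; trans; cong; cong₂; subst; subst₂; module ≡-Reasoning)
import Relation.Binary.Reasoning.PartialOrder as PartialOrderReasoning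
import Relation.Binary.Reasoning.Setoid as SetoidReasoning
open import Relation.Nullary using (yes; no)
open import Relation.Nullary.Decidable.Core using (recompute)

-- Real numbers

module OrderedField (em : ExcludedMiddle 0ℓ) (R : CompleteOrderedField) where
  open CompleteOrderedField R

  commutativeRing : CommutativeRing 0ℓ 0ℓ
  commutativeRing = record { isCommutativeRing = isCommutativeRing }

  open CommutativeRing commutativeRing public
    using (*-comm; *-assoc; *-identityˡ; *-identityʳ; distribˡ; distribʳ
          ; zeroʳ; -‿inverseʳ; ring; semiring; +-abelianGroup)
  open RingProperties ring public using (-‿distribˡ-*; -‿distribʳ-*; x[y-z]≈xy-xz; [y-z]x≈yx-zx)
  open AbelianGroupProperties +-abelianGroup public
    using (⁻¹-∙-comm; ⁻¹-involutive; ε⁻¹≈ε; ⁻¹-anti-homo‿-)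

  -- A coefficient (m , n) stands for m - n: deciding equality of integer
  -- coefficients lets the ring solver cancel.
  module Solver where
    open Multiples semiring using (×-homo-+; ×1-homo-*) renaming (_×_ to _·_)
    open CommutativeSemigroupProperties
      (CommutativeRing.+-commutativeSemigroup commutativeRing) using (interchange)

    coefficients : RawRing 0ℓ 0ℓ
    coefficients = record
      { Carrier = ℕ × ℕ
      ; _≈_     = _≡_
      ; _+_     = λ (a , b) (c , d) → a ℕ.+ c , b ℕ.+ d
      ; _*_     = λ (a , b) (c , d) → a ℕ.* c ℕ.+ b ℕ.* d , a ℕ.* d ℕ.+ b ℕ.* c
      ; -_      = λ (a , b) → b , a
      ; 0#      = 0 , 0
      ; 1#      = 1 , 0
      }

    eval : ℕ × ℕ → ℝ
    eval (a , b) = a · 1# - b · 1#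

    -‿interchange : ∀ x y z w → (x + y) - (z + w) ≡ (x - z) + (y - w)
    -‿interchange x y z w =
      trans (cong (x + y +_) (sym (⁻¹-∙-comm z w))) (interchange x y (- z) (- w))

    eval-+ : ∀ p q → eval (RawRing._+_ coefficients p q) ≡ eval p + eval q
    eval-+ (a , b) (c , d) =
      trans (cong₂ _-_ (×-homo-+ 1# a c) (×-homo-+ 1# b d)) (-‿interchange _ _ _ _)

    eval-* : ∀ p q → eval (RawRing._*_ coefficients p q) ≡ eval p * eval q
    eval-* (a , b) (c , d) = begin
      (a ℕ.* c ℕ.+ b ℕ.* d) · 1# - (a ℕ.* d ℕ.+ b ℕ.* c) · 1#
        ≡⟨ cong₂ _-_ (homo a c b d) (homo a d b c) ⟩
      (A * C + B * D) - (A * D + B * C)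
        ≡⟨ -‿interchange _ _ _ _ ⟩
      (A * C - A * D) + (B * D - B * C)
        ≡⟨ cong (A * C - A * D +_) (sym (⁻¹-anti-homo‿- (B * C) (B * D))) ⟩
      (A * C - A * D) - (B * C - B * D)
        ≡⟨ cong₂ _-_ (sym (x[y-z]≈xy-xz A C D)) (sym (x[y-z]≈xy-xz B C D)) ⟩
      A * (C - D) - B * (C - D)
        ≡⟨ sym ([y-z]x≈yx-zx (C - D) A B) ⟩
      (A - B) * (C - D) ∎
      where
      open ≡-Reasoning
      A = a · 1#
      B = b · 1#
      C = c · 1#
      D = d · 1#

      homo : ∀ k l m n → (k ℕ.* l ℕ.+ m ℕ.* n) · 1# ≡ k · 1# * (l · 1#) + m · 1# * (n · 1#)
      homo k l m n =
        trans (×-homo-+ 1# (k ℕ.* l) (m ℕ.* n)) (cong₂ _+_ (×1-homo-* k l) (×1-homo-* m n))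

    morphism : coefficients -Raw-AlmostCommutative⟶ fromCommutativeRing commutativeRing
    morphism = record
      { ⟦_⟧    = eval
      ; +-homo = eval-+
      ; *-homo = eval-*
      ; -‿homo = λ (a , b) → sym (⁻¹-anti-homo‿- (a · 1#) (b · 1#))
      ; 0-homo = -‿inverseʳ 0#
      ; 1-homo = trans (cong (1# +_) ε⁻¹≈ε) (+-identityʳ 1#)
      }

    cross : ∀ {x y z w} → x + w ≡ z + y → x - y ≡ z - w
    cross {x} {y} {z} {w} e = begin
      x - y             ≡⟨ sym (+-identityʳ _) ⟩
      x - y + 0#        ≡⟨ cong (x - y +_) (sym (-‿inverseʳ w)) ⟩
      x - y + (w - w)   ≡⟨ interchange x (- y) w (- w) ⟩
      x + w + (- y - w) ≡⟨ cong₂ _+_ e (+-comm (- y) (- w)) ⟩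
      z + y + (- w - y) ≡⟨ interchange z y (- w) (- y) ⟩
      z - w + (y - y)   ≡⟨ cong (z - w +_) (-‿inverseʳ y) ⟩
      z - w + 0#        ≡⟨ +-identityʳ _ ⟩
      z - w ∎
      where open ≡-Reasoning

    -- Several pairs stand for the same integer, so cross sums are compared instead of the pairs.
    _≟_ : WeaklyDecidable (Induced-equivalence morphism)
    (a , b) ≟ (c , d) with a ℕ.+ d ℕ.≟ c ℕ.+ b
    ... | no _  = nothing
    ... | yes p = just (cross (trans (sym (×-homo-+ 1# a d))
                                (trans (cong (_· 1#) p) (×-homo-+ 1# c b))))

    open RingSolver coefficients (fromCommutativeRing commutativeRing) morphism _≟_ public
      using (solve; _:=_; _:+_; _:*_; _:-_; :-_)

  open Solver using (solve; _:=_; _:+_; _:*_; _:-_; :-_)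

  -- Order and absolute value

  module ≤-Reasoning = PartialOrderReasoning (TotalOrder.poset totalOrder)

  open Max totalOrder public using (maxOperator)
  open MaxOp maxOperator public
    using () renaming (x≤x⊔y to x≤max; x≤y⊔x to y≤max; ⊔-lub to max-lub)
  open Min totalOrder public using (minOperator) renaming (_⊓_ to min)
  open MinOp minOperator public using (⊓-sel; x⊓y≤x; x⊓y≤y)
  open IsTotalOrder isTotalOrder public using (antisym; total; ≲-respʳ-≈; ≲-respˡ-≈)

  ≤-or-> : ∀ x y → x ≤ y ⊎ y < x
  ≤-or-> x y with em {x ≤ y}
  ... | yes x≤y = inj₁ x≤y
  ... | no  x≰y = inj₂ (Strict.≰⇒> _≡_ _≤_ sym ≤-reflexive total x≰y)

  <⇒≱ : ∀ {x y} → x < y → y ≤ x → ∀ {A : Set} → A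
  <⇒≱ (x≤y , x≢y) y≤x = ⊥-elim (x≢y (antisym x≤y y≤x))

  ≤-<-trans : ∀ {x y z} → x ≤ y → y < z → x < z
  ≤-<-trans = Strict.≤-<-trans _≡_ _≤_ ≤-trans antisym ≲-respˡ-≈

  <-≤-trans : ∀ {x y z} → x < y → y ≤ z → x < z
  <-≤-trans = Strict.<-≤-trans _≡_ _≤_ sym ≤-trans antisym ≲-respʳ-≈

  <⇒≤ : ∀ {x y} → x < y → x ≤ y
  <⇒≤ = proj₁

  min-pos : ∀ {x y} → 0# < x → 0# < y → 0# < min x y
  min-pos {x} {y} 0<x 0<y with ⊓-sel x y
  ... | inj₁ e = subst (0# <_) (sym e) 0<x
  ... | inj₂ e = subst (0# <_) (sym e) 0<y

  +-cancelʳ : ∀ {x y} z → x + z ≡ y + z → x ≡ y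
  +-cancelʳ {x} {y} z e = trans (lemma x z) (trans (cong (_- z) e) (sym (lemma y z)))
    where lemma = solve 2 (λ x z → x := (x :+ z) :- z) refl

  +-monoˡ-< : ∀ z {x y} → x < y → x + z < y + z
  +-monoˡ-< z (x≤y , x≢y) = +-monoˡ-≤ z x≤y , λ e → x≢y (+-cancelʳ z e)

  +-mono-<-≤ : ∀ {w x y z} → w < x → y ≤ z → w + y < x + z
  +-mono-<-≤ {w} {x} {y} {z} w<x y≤z =
    <-≤-trans (+-monoˡ-< y w<x) (+-mono-≤ ≤-refl y≤z)

  x≤y⇒0≤y-x : ∀ {x y} → x ≤ y → 0# ≤ y - x
  x≤y⇒0≤y-x {x} x≤y = subst (_≤ _) (-‿inverseʳ x) (+-monoˡ-≤ (- x) x≤y)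

  x≤0⇒0≤-x : ∀ {x} → x ≤ 0# → 0# ≤ - x
  x≤0⇒0≤-x {x} x≤0 = subst (0# ≤_) (+-identityˡ (- x)) (x≤y⇒0≤y-x x≤0)

  x<y⇒0<y-x : ∀ {x y} → x < y → 0# < y - x
  x<y⇒0<y-x {x} x<y = subst (_< _) (-‿inverseʳ x) (+-monoˡ-< (- x) x<y)

  0≤y-x⇒x≤y : ∀ {x y} → 0# ≤ y - x → x ≤ y
  0≤y-x⇒x≤y {x} {y} p = subst₂ _≤_ (+-identityˡ x) (lemma x y) (+-monoˡ-≤ x p)
    where lemma = solve 2 (λ x y → (y :- x) :+ x := y) refl

  -‿anti-≤ : ∀ {x y} → x ≤ y → - y ≤ - x
  -‿anti-≤ {x} {y} p = 0≤y-x⇒x≤y (subst (0# ≤_) (lemma x y) (x≤y⇒0≤y-x p))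
    where lemma = solve 2 (λ x y → y :- x := (:- x) :- (:- y)) refl

  *-monoʳ-≤ : ∀ {c x y} → 0# ≤ c → x ≤ y → c * x ≤ c * y
  *-monoʳ-≤ {c} {x} {y} 0≤c x≤y =
    0≤y-x⇒x≤y (subst (0# ≤_) (x[y-z]≈xy-xz c y x) (*-nonNegative 0≤c (x≤y⇒0≤y-x x≤y)))

  *-monoˡ-≤ : ∀ {c x y} → 0# ≤ c → x ≤ y → x * c ≤ y * c
  *-monoˡ-≤ 0≤c x≤y = subst₂ _≤_ (*-comm _ _) (*-comm _ _) (*-monoʳ-≤ 0≤c x≤y)

  -- From `1# ≤ 0#` it would follow that `- 1#` is nonnegative, and so is its square `1#`.
  0<1 : 0# < 1#
  0<1 with total 0# 1#
  ... | inj₁ 0≤1 = 0≤1 , 0≢1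
  ... | inj₂ 1≤0 = ⊥-elim (0≢1 (antisym (subst (0# ≤_) lemma (*-nonNegative 0≤-1 0≤-1)) 1≤0))
    where
    0≤-1 = x≤0⇒0≤-x 1≤0

    lemma : - 1# * - 1# ≡ 1#
    lemma = trans (solve 1 (λ x → (:- x) :* (:- x) := x :* x) refl 1#) (*-identityˡ 1#)

  -- A nonpositive inverse would give `1# ≤ 0#` after multiplication by `x`.
  inverse-pos : ∀ {x} → 0# < x → ∃ λ y → 0# < y × x * y ≡ 1#
  inverse-pos {x} (0≤x , 0≢x) with inverse x (λ e → 0≢x (sym e))
  ... | y , e with ≤-or-> y 0#
  ...   | inj₂ 0<y = y , 0<y , e
  ...   | inj₁ y≤0 = <⇒≱ 0<1 (subst₂ _≤_ e (zeroʳ x) (*-monoʳ-≤ 0≤x y≤0))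

  *-monoʳ-< : ∀ {c x y} → 0# < c → x < y → c * x < c * y
  *-monoʳ-< {c} {x} {y} 0<c (x≤y , x≢y) = *-monoʳ-≤ (<⇒≤ 0<c) x≤y , λ e → x≢y (begin
    x           ≡⟨ cancel x ⟨
    d * (c * x) ≡⟨ cong (d *_) e ⟩
    d * (c * y) ≡⟨ cancel y ⟩
    y           ∎)
    where
    open ≡-Reasoning
    d = proj₁ (inverse-pos 0<c)

    cancel : ∀ z → d * (c * z) ≡ z
    cancel z = trans (solve 3 (λ d c z → d :* (c :* z) := (c :* d) :* z) refl d c z)
      (trans (cong (_* z) (proj₂ (proj₂ (inverse-pos 0<c)))) (*-identityˡ z))

  0<2 : 0# < 1# + 1#
  0<2 = subst (_< 1# + 1#) (+-identityˡ 0#) (+-mono-<-≤ 0<1 (<⇒≤ 0<1))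

  -- The inequality leaves room below a bound; the equation splits an error in two.
  halve : ∀ {δ} → 0# < δ → ∃ λ δ′ → 0# < δ′ × δ′ < δ × δ′ + δ′ ≡ δ
  halve {δ} 0<δ with inverse-pos 0<2
  ... | h , 0<h , e =
    δ * h , 0<δh , subst₂ _<_ (+-identityˡ _) double (+-monoˡ-< (δ * h) 0<δh) , double
    where
    0<δh : 0# < δ * h
    0<δh = subst (_< δ * h) (zeroʳ δ) (*-monoʳ-< 0<δ 0<h)

    double : δ * h + δ * h ≡ δ
    double = begin
      δ * h + δ * h         ≡⟨ distribˡ δ h h ⟨
      δ * (h + h)           ≡⟨ cong (δ *_) (cong₂ _+_ (*-identityˡ h) (*-identityˡ h)) ⟨
      δ * (1# * h + 1# * h) ≡⟨ cong (δ *_) (distribʳ h 1# 1#) ⟨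
      δ * ((1# + 1#) * h)   ≡⟨ cong (δ *_) e ⟩
      δ * 1#                ≡⟨ *-identityʳ δ ⟩
      δ                     ∎
      where open ≡-Reasoning

  x≤∣x∣ : ∀ x → x ≤ ∣ x ∣
  x≤∣x∣ x = x≤max x (- x)

  -x≤∣x∣ : ∀ x → - x ≤ ∣ x ∣
  -x≤∣x∣ x = y≤max x (- x)

  ∣∣-lub : ∀ {x c} → x ≤ c → - x ≤ c → ∣ x ∣ ≤ c
  ∣∣-lub = max-lub

  0≤∣x∣ : ∀ x → 0# ≤ ∣ x ∣
  0≤∣x∣ x with total 0# x
  ... | inj₁ p = ≤-trans p (x≤∣x∣ x)
  ... | inj₂ p = ≤-trans (x≤0⇒0≤-x p) (-x≤∣x∣ x)

  ∣x+y∣≤∣x∣+∣y∣ : ∀ x y → ∣ x + y ∣ ≤ ∣ x ∣ + ∣ y ∣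
  ∣x+y∣≤∣x∣+∣y∣ x y = ∣∣-lub (+-mono-≤ (x≤∣x∣ x) (x≤∣x∣ y))
    (subst (_≤ ∣ x ∣ + ∣ y ∣) (⁻¹-∙-comm x y) (+-mono-≤ (-x≤∣x∣ x) (-x≤∣x∣ y)))

  ∣-x∣≤∣x∣ : ∀ x → ∣ - x ∣ ≤ ∣ x ∣
  ∣-x∣≤∣x∣ x = ∣∣-lub (-x≤∣x∣ x) (subst (_≤ ∣ x ∣) (sym (⁻¹-involutive x)) (x≤∣x∣ x))

  nonNeg⇒∣x∣≤x : ∀ {x} → 0# ≤ x → ∣ x ∣ ≤ x
  nonNeg⇒∣x∣≤x 0≤x = ∣∣-lub ≤-refl (≤-trans (subst (- _ ≤_) ε⁻¹≈ε (-‿anti-≤ 0≤x)) 0≤x)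

  ∣x*y∣≤∣x∣*∣y∣ : ∀ x y → ∣ x * y ∣ ≤ ∣ x ∣ * ∣ y ∣
  ∣x*y∣≤∣x∣*∣y∣ x y with total 0# x
  ... | inj₁ 0≤x = ≤-trans
    (∣∣-lub (*-monoʳ-≤ 0≤x (x≤∣x∣ y))
      (subst (_≤ x * ∣ y ∣) (sym (-‿distribʳ-* x y)) (*-monoʳ-≤ 0≤x (-x≤∣x∣ y))))
    (*-monoˡ-≤ (0≤∣x∣ y) (x≤∣x∣ x))
  ... | inj₂ x≤0 = ≤-trans
    (∣∣-lub
      (subst (_≤ - x * ∣ y ∣) (solve 2 (λ x y → (:- x) :* (:- y) := x :* y) refl x y)
        (*-monoʳ-≤ (x≤0⇒0≤-x x≤0) (-x≤∣x∣ y)))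
      (subst (_≤ - x * ∣ y ∣) (sym (-‿distribˡ-* x y)) (*-monoʳ-≤ (x≤0⇒0≤-x x≤0) (x≤∣x∣ y))))
    (*-monoˡ-≤ (0≤∣x∣ y) (-x≤∣x∣ x))

-- Uniqueness of solutions

module ODE (em : ExcludedMiddle 0ℓ) (R : CompleteOrderedField) where
  open CompleteOrderedField R
  open Analysis R
  open OrderedField em R
  open Solver using (solve; _:=_; _:+_; _:*_; _:-_; :-_)

  -- The maximum norm

  0≤‖x‖ : ∀ {n} (x : ℝ^ n) → 0# ≤ ‖ x ‖
  0≤‖x‖ {ℕ.zero}  x = ≤-refl
  0≤‖x‖ {ℕ.suc n} x = ≤-trans (0≤∣x∣ (x zero)) (x≤max _ _)

  ∣xᵢ∣≤‖x‖ : ∀ {n} (x : ℝ^ n) i → ∣ x i ∣ ≤ ‖ x ‖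
  ∣xᵢ∣≤‖x‖ x zero    = x≤max _ _
  ∣xᵢ∣≤‖x‖ x (suc i) = ≤-trans (∣xᵢ∣≤‖x‖ (x ∘ suc) i) (y≤max _ _)

  ‖‖-lub : ∀ {n} {x : ℝ^ n} {c} → 0# ≤ c → (∀ i → ∣ x i ∣ ≤ c) → ‖ x ‖ ≤ c
  ‖‖-lub {ℕ.zero}  0≤c p = 0≤c
  ‖‖-lub {ℕ.suc n} 0≤c p = max-lub (p zero) (‖‖-lub 0≤c (p ∘ suc))

  -- The decomposition is pointwise because vectors are functions and extensionality is not assumed
  -- here.
  ‖‖-triangle : ∀ {n} {x : ℝ^ n} (y z : ℝ^ n) → (∀ i → x i ≡ y i + z i) → ‖ x ‖ ≤ ‖ y ‖ + ‖ z ‖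
  ‖‖-triangle y z e =
    ‖‖-lub (subst (_≤ ‖ y ‖ + ‖ z ‖) (+-identityˡ 0#) (+-mono-≤ (0≤‖x‖ y) (0≤‖x‖ z)))
      λ i → ≤-trans (≤-reflexive (cong ∣_∣ (e i)))
              (≤-trans (∣x+y∣≤∣x∣+∣y∣ (y i) (z i)) (+-mono-≤ (∣xᵢ∣≤‖x‖ y i) (∣xᵢ∣≤‖x‖ z i)))

  ‖‖-negate : ∀ {n} {x : ℝ^ n} (y : ℝ^ n) → (∀ i → x i ≡ - y i) → ‖ x ‖ ≤ ‖ y ‖
  ‖‖-negate y e = ‖‖-lub (0≤‖x‖ y) λ i →
    ≤-trans (≤-reflexive (cong ∣_∣ (e i))) (≤-trans (∣-x∣≤∣x∣ (y i)) (∣xᵢ∣≤‖x‖ y i))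

  ‖⊖‖-sym : ∀ {n} (x y : ℝ^ n) → ‖ x ⊖ y ‖ ≤ ‖ y ⊖ x ‖
  ‖⊖‖-sym x y = ‖‖-negate (y ⊖ x) λ i → sym (⁻¹-anti-homo‿- (y i) (x i))

  ‖⊖‖-triangle : ∀ {n} (x y z : ℝ^ n) → ‖ x ⊖ z ‖ ≤ ‖ x ⊖ y ‖ + ‖ y ⊖ z ‖
  ‖⊖‖-triangle x y z = ‖‖-triangle (x ⊖ y) (y ⊖ z)
    λ i → solve 3 (λ x y z → x :- z := (x :- y) :+ (y :- z)) refl (x i) (y i) (z i)

  ‖⊙‖ : ∀ {n} c (x : ℝ^ n) → ‖ c ⊙ x ‖ ≤ ∣ c ∣ * ‖ x ‖
  ‖⊙‖ c x = ‖‖-lub (*-nonNegative (0≤∣x∣ c) (0≤‖x‖ x)) λ i →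
    ≤-trans (∣x*y∣≤∣x∣*∣y∣ c (x i)) (*-monoʳ-≤ (0≤∣x∣ c) (∣xᵢ∣≤‖x‖ x i))

  ‖x‖≤0⇒x≗0 : ∀ {n} (x : ℝ^ n) → ‖ x ‖ ≤ 0# → ∀ i → x i ≡ 0#
  ‖x‖≤0⇒x≗0 x p i = antisym (≤-trans (x≤∣x∣ (x i)) q)
    (subst₂ _≤_ ε⁻¹≈ε (⁻¹-involutive (x i)) (-‿anti-≤ (≤-trans (-x≤∣x∣ (x i)) q)))
    where q = ≤-trans (∣xᵢ∣≤‖x‖ x i) p

  x≗y⇒‖x⊖y‖≤c : ∀ {n} (x y : ℝ^ n) {c} → 0# ≤ c → (∀ i → x i ≡ y i) → ‖ x ⊖ y ‖ ≤ c
  x≗y⇒‖x⊖y‖≤c _ y {c} 0≤c e = ‖‖-lub 0≤c λ i →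
    subst (λ z → ∣ z ∣ ≤ c) (sym (trans (cong (_- y i) (e i)) (-‿inverseʳ (y i))))
      (∣∣-lub 0≤c (subst (_≤ c) (sym ε⁻¹≈ε) 0≤c))

  unit-speed : ℝ → ℝ^ 1 → ℝ^ 1
  unit-speed _ _ _ = 1#

  unit-speed-continuous : Continuous unit-speed
  unit-speed-continuous s x ε 0<ε = 1# , 0<1 , λ s′ x′ _ _ →
    ≤-<-trans (x≗y⇒‖x⊖y‖≤c (unit-speed s′ x′) (unit-speed s x) ≤-refl λ _ → refl) 0<ε

  unit-speed-lipschitz : LocallyLipschitz₂ unit-speed
  unit-speed-lipschitz _ _ = 1# , 0<1 , 0# , λ s y z _ _ _ →
    x≗y⇒‖x⊖y‖≤c (unit-speed s y) (unit-speed s z) (*-nonNegative ≤-refl (0≤‖x‖ (y ⊖ z)))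
      λ _ → refl

  -- Calculus on a closed interval

  module _ (t : ℝ≥0) where

    between : (a b : [0, t ]) (c : ℝ) → .(value a ≤ c) → .(c ≤ value b) → [0, t ]
    between (a , [ 0≤a≤t ]) (b , [ 0≤b≤t ]) c a≤c c≤b =
      c , [ ≤-trans (proj₁ 0≤a≤t) a≤c , ≤-trans c≤b (proj₂ 0≤b≤t) ]

    0≤value : (u : [0, t ]) → 0# ≤ value u
    -- Membership proofs are irrelevant; excluded middle decides the proposition and so recovers a
    -- usable proof.
    0≤value (u , [ p ]) = recompute em (proj₁ p)

    Near : ℝ → [0, t ] → [0, t ] → Set
    Near δ v u = ∣ value u - value v ∣ < δ

    near : ∀ {δ} (v u : [0, t ]) → value v - value u < δ → value u - value v < δ → Near δ v u
    near {δ} v u p q with total (value u - value v) (- (value u - value v))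
    ... | inj₁ h≤-h = ≤-<-trans (∣∣-lub h≤-h ≤-refl)
                        (subst (_< δ) (sym (⁻¹-anti-homo‿- (value u) (value v))) p)
    ... | inj₂ -h≤h = ≤-<-trans (∣∣-lub ≤-refl -h≤h) q

    ordered-near : ∀ {δ} (v u : [0, t ]) → value v ≤ value u → value u - value v < δ → Near δ v u
    ordered-near v u v≤u = ≤-<-trans (nonNeg⇒∣x∣≤x (x≤y⇒0≤y-x v≤u))

    Locally : [0, t ] → ([0, t ] → Set) → Set
    Locally v P = ∃ λ δ → 0# < δ × (∀ u → Near δ v u → P u)

    locally-map : ∀ v {P Q} → (∀ u → P u → Q u) → Locally v P → Locally v Q
    locally-map _ f (δ , 0<δ , p) = δ , 0<δ , λ u n → f u (p u n)

    locally-zip : ∀ v {P Q : [0, t ] → Set} →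
                  Locally v P → Locally v Q → Locally v (λ u → P u × Q u)
    locally-zip _ (δ , 0<δ , p) (δ′ , 0<δ′ , q) =
      min δ δ′ , min-pos 0<δ 0<δ′ ,
      λ u n → p u (<-≤-trans n (x⊓y≤x δ δ′)) , q u (<-≤-trans n (x⊓y≤y δ δ′))

    -- Let c be the supremum of the points u of [a , b] with P a u. Some
    -- such u is so close to c that P u c, so P a c; if c < b, then P c u′
    -- for some u′ > c, contradicting the choice of c.
    local-to-global : (P : Rel [0, t ] 0ℓ) → Transitive P → ∀ a b → value a ≤ value b →
      (∀ v → value a ≤ value v → value v ≤ value b →
        Locally v λ u → value a ≤ value u → value u ≤ value b →
          (value u ≤ value v → P u v) × (value v ≤ value u → P v u)) →
      P a b
    local-to-global P P-trans a b a≤b loc =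
      let s , upper , least = supremum S (value a , Saa) (value b , λ _ (_ , _ , _ , p , _) → p)
          a≤s = upper _ Saa
          s≤b = least _ λ _ (_ , _ , _ , p , _) → p
          c   = between a b s a≤s s≤b
          _ , 0<δ , at-c = loc c a≤s s≤b
      in conclusion c upper least a≤s s≤b 0<δ at-c
      where
      S : ℝ → Set
      S r = ∃ λ u → value u ≡ r × value a ≤ r × r ≤ value b × P a u

      -- Reflexivity at `a` comes from the local hypothesis at `a`, applied to the point `a` itself.
      Saa : S (value a)
      Saa = let δ , 0<δ , p = loc a ≤-refl a≤b in
        a , refl , ≤-refl , a≤b ,
        proj₁ (p a (ordered-near a a ≤-refl (subst (_< δ) (sym (-‿inverseʳ (value a))) 0<δ))
                 ≤-refl a≤b)
          ≤-refl

      module _ (c : [0, t ]) {δ} (upper : ∀ r → S r → r ≤ value c)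
        (least : ∀ r → (∀ r′ → S r′ → r′ ≤ r) → value c ≤ r)
        (a≤s : value a ≤ value c) (s≤b : value c ≤ value b) (0<δ : 0# < δ)
        (at-c : ∀ u → Near δ c u → value a ≤ value u → value u ≤ value b →
                (value u ≤ value c → P u c) × (value c ≤ value u → P c u))
        where
        s : ℝ
        s = value c

        s-δ<s : s - δ < s
        s-δ<s = subst₂ _<_ (+-identityˡ _) (solve 2 (λ s δ → δ :+ (s :- δ) := s) refl s δ)
                  (+-monoˡ-< (s - δ) 0<δ)

        -- Otherwise `s - δ` would be an upper bound of `S` below the least one.
        close : ∃ λ r → S r × s - δ < r
        close with em {∃ λ r → S r × s - δ < r}
        ... | yes p = p
        ... | no ∄r = <⇒≱ s-δ<s (least (s - δ) below)
          where
          below : ∀ r → S r → r ≤ s - δ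
          below r Sr with ≤-or-> r (s - δ)
          ... | inj₁ p = p
          ... | inj₂ p = ⊥-elim (∄r (r , Sr , p))

        Pac : P a c
        Pac with close
        ... | r , Sr@(u , refl , a≤u , u≤b , Pau) , s-δ<u =
          P-trans Pau (proj₁ (at-c u (near c u s-u<δ (≤-<-trans u-s≤0 0<δ)) a≤u u≤b) u≤s)
          where
          u≤s = upper _ Sr

          u-s≤0 : r - s ≤ 0#
          u-s≤0 = subst (r - s ≤_) (-‿inverseʳ s) (+-monoˡ-≤ (- s) u≤s)

          s-u<δ : s - r < δ
          s-u<δ = subst₂ _<_ (solve 3 (λ s δ r → (s :- δ) :+ (δ :- r) := s :- r) refl s δ r)
                             (solve 2 (λ δ r → r :+ (δ :- r) := δ) refl δ r)
                    (+-monoˡ-< (δ - r) s-δ<u)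

        no-gap : ∀ {η} → 0# < η → η < δ → η ≤ value b - s → P a b
        no-gap {η} 0<η η<δ η≤b-s = <⇒≱ s<r
          (upper r (u , refl , a≤r , r≤b ,
                    P-trans Pac (proj₂ (at-c u (ordered-near c u s≤r r-s<δ) a≤r r≤b) s≤r)))
          where
          r = η + s

          s<r : s < r
          s<r = subst (_< r) (+-identityˡ s) (+-monoˡ-< s 0<η)

          s≤r = <⇒≤ s<r
          a≤r = ≤-trans a≤s s≤r

          r≤b : r ≤ value b
          r≤b = subst (r ≤_) (solve 2 (λ b s → (b :- s) :+ s := b) refl (value b) s)
                  (+-monoˡ-≤ s η≤b-s)

          u : [0, t ]
          u = between c b r s≤r r≤b

          r-s<δ : r - s < δ
          r-s<δ = subst (_< δ) (solve 2 (λ η s → η := (η :+ s) :- s) refl η s) η<δ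

        conclusion : P a b
        conclusion with ≤-or-> (value b) s
        ... | inj₁ b≤s = subst (P a) c≡b Pac
          where
          c≡b : c ≡ b
          c≡b with antisym b≤s s≤b
          ... | refl = refl
        ... | inj₂ s<b =
          -- Half the minimum of `δ` and `b - s` is strictly less than `δ` and keeps `η + s` at most
          -- `b`.
          let _ , 0<η , η<min , _ = halve (min-pos 0<δ (x<y⇒0<y-x s<b)) in
          no-gap 0<η (<-≤-trans η<min (x⊓y≤x _ _)) (≤-trans (<⇒≤ η<min) (x⊓y≤y _ _))

    -- The bound is additive over adjacent intervals, hence transitive as a relation on points, so
    -- `local-to-global` patches the local bounds together.
    mean-value-inequality : ∀ {n} (z : [0, t ] → ℝ^ n) K a b → value a ≤ value b →
      (∀ v → value a ≤ value v → value v ≤ value b →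
        Locally v λ u → ‖ z u ⊖ z v ‖ ≤ K * ∣ value u - value v ∣) →
      0# ≤ K →
      ‖ z b ⊖ z a ‖ ≤ K * (value b - value a)
    mean-value-inequality z K a b a≤b loc 0≤K =
      local-to-global (λ u v → ‖ z v ⊖ z u ‖ ≤ K * (value v - value u)) additive a b a≤b
        λ v a≤v v≤b → locally-map v (λ u p _ _ →
            (λ u≤v → ≤-trans (‖⊖‖-sym (z v) (z u)) (≤-trans p (*-monoʳ-≤ 0≤K
               (subst (∣ value u - value v ∣ ≤_) (⁻¹-anti-homo‿- (value u) (value v))
                 (∣∣-lub (≤-trans (x≤y⇒y-x≤0 u≤v) (0≤-‿ u≤v)) ≤-refl)))))
          , (λ v≤u → ≤-trans p (*-monoʳ-≤ 0≤K (nonNeg⇒∣x∣≤x (x≤y⇒0≤y-x v≤u)))))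
          (loc v a≤v v≤b)
      where
      x≤y⇒y-x≤0 : ∀ {x y} → x ≤ y → x - y ≤ 0#
      x≤y⇒y-x≤0 {y = y} x≤y = subst (_ ≤_) (-‿inverseʳ y) (+-monoˡ-≤ (- y) x≤y)

      0≤-‿ : ∀ {x y} → x ≤ y → 0# ≤ - (x - y)
      0≤-‿ x≤y = subst (0# ≤_) (sym (⁻¹-anti-homo‿- _ _)) (x≤y⇒0≤y-x x≤y)

      additive : Transitive (λ u v → ‖ z v ⊖ z u ‖ ≤ K * (value v - value u))
      additive {u} {v} {w} p q = ≤-trans (‖⊖‖-triangle (z w) (z v) (z u))
        (≤-trans (+-mono-≤ q p) (≤-reflexive
          (solve 4 (λ K u v w → K :* (w :- v) :+ K :* (v :- u) := K :* (w :- u)) refl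
             K (value u) (value v) (value w))))

    -- The gap `K - ‖ w ‖` serves as the error in the definition of the derivative; the linear part
    -- contributes the remaining `‖ w ‖`.
    derivative-bound : ∀ {n} (z : [0, t ] → ℝ^ n) v {w K} → HasDerivative t z v w → ‖ w ‖ < K →
      Locally v λ u → ‖ z u ⊖ z v ‖ ≤ K * ∣ value u - value v ∣
    derivative-bound z v {w} {K} z′ ‖w‖<K =
      locally-map v (λ u p → begin
        ‖ z u ⊖ z v ‖
          ≤⟨ ‖‖-triangle ((z u ⊖ z v) ⊖ h u ⊙ w) (h u ⊙ w)
               (λ i → solve 2 (λ a b → a := (a :- b) :+ b) refl (z u i - z v i) (h u * w i)) ⟩
        ‖ (z u ⊖ z v) ⊖ h u ⊙ w ‖ + ‖ h u ⊙ w ‖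
          ≤⟨ +-mono-≤ p (‖⊙‖ (h u) w) ⟩
        (K - ‖ w ‖) * ∣ h u ∣ + ∣ h u ∣ * ‖ w ‖
          ≡⟨ solve 3 (λ K w h → (K :- w) :* h :+ h :* w := K :* h) refl K ‖ w ‖ ∣ h u ∣ ⟩
        K * ∣ h u ∣ ∎)
        (z′ (K - ‖ w ‖) (x<y⇒0<y-x ‖w‖<K))
      where
      open ≤-Reasoning
      h : [0, t ] → ℝ
      h u = value u - value v

    -- Near `v` the increment is at most `1# + ‖ w ‖` times the distance, so it suffices to stay
    -- closer than `ε` divided by that constant.
    differentiable⇒continuous : ∀ {n} (z : [0, t ] → ℝ^ n) v {w} → HasDerivative t z v w →
      ∀ {ε} → 0# < ε → Locally v λ u → ‖ z u ⊖ z v ‖ < ε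
    differentiable⇒continuous z v {w} z′ {ε} 0<ε =
      let K    = 1# + ‖ w ‖
          w<K  = subst (_< K) (+-identityˡ ‖ w ‖) (+-monoˡ-< ‖ w ‖ 0<1)
          0<K  = ≤-<-trans (0≤‖x‖ w) w<K
          k , 0<k , Kk≡1 = inverse-pos 0<K
          0<kε = subst (_< k * ε) (zeroʳ k) (*-monoʳ-< 0<k 0<ε)
          Kkε≡ε = trans (sym (*-assoc K k ε)) (trans (cong (_* ε) Kk≡1) (*-identityˡ ε))
      in locally-map v (λ u (p , q) →
             ≤-<-trans p (subst (K * ∣ value u - value v ∣ <_) Kkε≡ε (*-monoʳ-< 0<K q)))
           (locally-zip v (derivative-bound z v z′ w<K) (k * ε , 0<kε , λ u → id))

    ⊖-hasDerivative : ∀ {n} (x y : [0, t ] → ℝ^ n) s {v w} →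
                      HasDerivative t x s v → HasDerivative t y s w →
                      HasDerivative t (λ u → x u ⊖ y u) s (v ⊖ w)
    ⊖-hasDerivative x y s {v} {w} x′ y′ ε 0<ε =
      let ε′ , 0<ε′ , _ , ε′+ε′≡ε = halve 0<ε
      in locally-map s (λ u (p , q) → begin
        ‖ ((x u ⊖ y u) ⊖ (x s ⊖ y s)) ⊖ h u ⊙ (v ⊖ w) ‖
          ≤⟨ ‖‖-triangle ((x u ⊖ x s) ⊖ h u ⊙ v) ((y s ⊖ y u) ⊖ h u ⊙ (λ i → - w i)) (λ i →
               solve 7 (λ xu xs yu ys h v w → ((xu :- yu) :- (xs :- ys)) :- (h :* (v :- w))
                          := ((xu :- xs) :- h :* v) :+ ((ys :- yu) :- h :* (:- w))) refl
                 (x u i) (x s i) (y u i) (y s i) (h u) (v i) (w i)) ⟩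
        ‖ (x u ⊖ x s) ⊖ h u ⊙ v ‖ + ‖ (y s ⊖ y u) ⊖ h u ⊙ (λ i → - w i) ‖
          ≤⟨ +-mono-≤ p (≤-trans (‖‖-negate ((y u ⊖ y s) ⊖ h u ⊙ w) (λ i →
               solve 4 (λ yu ys h w → (ys :- yu) :- h :* (:- w) := :- ((yu :- ys) :- h :* w)) refl
                 (y u i) (y s i) (h u) (w i))) q) ⟩
        ε′ * ∣ h u ∣ + ε′ * ∣ h u ∣
          ≡⟨ distribʳ ∣ h u ∣ ε′ ε′ ⟨
        (ε′ + ε′) * ∣ h u ∣
          ≡⟨ cong (_* ∣ h u ∣) ε′+ε′≡ε ⟩
        ε * ∣ h u ∣ ∎)
        (locally-zip s (x′ ε′ 0<ε′) (y′ ε′ 0<ε′))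
      where
      open ≤-Reasoning
      h : [0, t ] → ℝ
      h u = value u - value s

    -- Two solutions of one locally Lipschitz equation

    module _ {n} (F : ℝ → ℝ^ n → ℝ^ n) (lip : LocallyLipschitz₂ F) (x y : [0, t ] → ℝ^ n)
      (x′ : ∀ s → HasDerivative t x s (F (value s) (x s)))
      (y′ : ∀ s → HasDerivative t y s (F (value s) (y s)))
      where
      private
        z : [0, t ] → ℝ^ n
        z u = x u ⊖ y u

        z′ : ∀ s → HasDerivative t z s (F (value s) (x s) ⊖ F (value s) (y s))
        z′ s = ⊖-hasDerivative x y s (x′ s) (y′ s)

      -- With B the supremum of ‖ z ‖ on [s , b] and C > 0 one more than a
      -- Lipschitz constant, the mean value inequality gives B ≤ C B (b - s),
      -- whence B = 0 as soon as C (b - s) < 1.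
      agree-locally : ∀ s → ‖ z s ‖ ≤ 0# → Locally s λ b → value s ≤ value b → ‖ z b ‖ ≤ 0#
      agree-locally s zs≤0 with lip (value s) (x s)
      ... | δ , 0<δ , L , F-lip =
        locally-map s conclusion (locally-zip s near-s short)
        where
        xs≗ys : ∀ i → x s i ≡ y s i
        xs≗ys i = +-cancelʳ (- y s i) (trans (‖x‖≤0⇒x≗0 (z s) zs≤0 i) (sym (-‿inverseʳ (y s i))))

        -- `L` may be negative, hence the maximum; the added `1#` makes the bound in `speed` strict,
        -- as `derivative-bound` requires.
        C = max L 0# + 1#

        0≤max = y≤max L 0#

        0<C : 0# < C
        0<C = subst₂ _<_ (+-identityˡ 0#) (+-comm 1# _) (+-mono-<-≤ 0<1 0≤max)

        short : Locally s λ b → C * ∣ value b - value s ∣ < 1#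
        short = let k , 0<k , Ck≡1 = inverse-pos 0<C in
          k , 0<k , λ b p → subst (C * ∣ value b - value s ∣ <_) Ck≡1 (*-monoʳ-< 0<C p)

        -- The conditions for `F-lip`, centred at `x s`, to apply to `x u` and `y u`; the second is
        -- close to `x s` because `y s` agrees with `x s`.
        Tame : [0, t ] → Set
        Tame u = ∣ value u - value s ∣ < δ × ‖ x u ⊖ x s ‖ < δ × ‖ y u ⊖ x s ‖ < δ

        -- The neighbourhood is kept explicit, as it is order convex.
        near-s : Locally s λ b → ∀ u → value s ≤ value u → value u ≤ value b → Tame u
        near-s =
          let δ′ , 0<δ′ , tame = locally-zip s (δ , 0<δ , λ _ → id) (locally-zip s
                (differentiable⇒continuous x s (x′ s) 0<δ)
                (locally-map s (λ u → ≤-<-trans (≤-trans (‖⊖‖-triangle (y u) (y s) (x s))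
                     (subst (‖ y u ⊖ y s ‖ + ‖ y s ⊖ x s ‖ ≤_) (+-identityʳ _)
                       (+-mono-≤ ≤-refl (x≗y⇒‖x⊖y‖≤c (y s) (x s) ≤-refl (sym ∘ xs≗ys))))))
                  (differentiable⇒continuous y s (y′ s) 0<δ)))
          in δ′ , 0<δ′ , λ b b-near u s≤u u≤b → tame u (ordered-near s u s≤u
               (≤-<-trans (≤-trans (+-monoˡ-≤ (- value s) u≤b) (x≤∣x∣ _)) b-near))

        conclusion : ∀ b → (∀ u → value s ≤ value u → value u ≤ value b → Tame u) ×
                           C * ∣ value b - value s ∣ < 1# →
                     value s ≤ value b → ‖ z b ‖ ≤ 0#
        conclusion b (tame , C∣b-s∣<1) s≤b = ≤-trans (upper b s≤b ≤-refl) B≤0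
          where
          S : ℝ → Set
          S r = ∃ λ u → ‖ z u ‖ ≡ r × value s ≤ value u × value u ≤ value b

          -- Both solutions stay within `δ` of `x s`, so the supremum exists without an appeal to
          -- compactness.
          bounded : ∀ r → S r → r ≤ δ + δ
          bounded _ (u , refl , s≤u , u≤b) = let _ , p , q = tame u s≤u u≤b in
            ≤-trans (‖⊖‖-triangle (x u) (x s) (y u))
              (+-mono-≤ (<⇒≤ p) (≤-trans (‖⊖‖-sym (x s) (y u)) (<⇒≤ q)))

          sup = supremum S (‖ z s ‖ , s , refl , ≤-refl , s≤b) (δ + δ , bounded)
          B   = proj₁ sup

          upper : ∀ u → value s ≤ value u → value u ≤ value b → ‖ z u ‖ ≤ B
          upper u s≤u u≤b = proj₁ (proj₂ sup) _ (u , refl , s≤u , u≤b)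

          speed : 0# < B → ∀ v → value s ≤ value v → value v ≤ value b →
                  ‖ F (value v) (x v) ⊖ F (value v) (y v) ‖ < C * B
          speed 0<B v s≤v v≤b = let near-v , p , q = tame v s≤v v≤b in begin-strict
            ‖ F (value v) (x v) ⊖ F (value v) (y v) ‖ ≤⟨ F-lip (value v) (x v) (y v) near-v p q ⟩
            L * ‖ z v ‖            ≤⟨ *-monoˡ-≤ (0≤‖x‖ (z v)) (x≤max L 0#) ⟩
            max L 0# * ‖ z v ‖     ≤⟨ *-monoʳ-≤ 0≤max (upper v s≤v v≤b) ⟩
            max L 0# * B           ≡⟨ +-identityˡ _ ⟨
            0# + max L 0# * B      <⟨ +-monoˡ-< _ 0<B ⟩
            B + max L 0# * B       ≡⟨ cong (_+ max L 0# * B) (*-identityˡ B) ⟨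
            1# * B + max L 0# * B  ≡⟨ +-comm _ _ ⟩
            max L 0# * B + 1# * B  ≡⟨ distribʳ B _ _ ⟨
            C * B                  ∎
            where open ≤-Reasoning

          improved : 0# < B → ∀ r → S r → r ≤ B * (C * ∣ value b - value s ∣)
          improved 0<B _ (u , refl , s≤u , u≤b) = begin
            ‖ z u ‖
              ≤⟨ ‖‖-triangle (z u ⊖ z s) (z s) (λ i →
                   solve 2 (λ a b → a := (a :- b) :+ b) refl (z u i) (z s i)) ⟩
            ‖ z u ⊖ z s ‖ + ‖ z s ‖
              ≤⟨ +-mono-≤
                   (mean-value-inequality z (C * B) s u s≤u
                     (λ v s≤v v≤u → derivative-bound z v (z′ v) (speed 0<B v s≤v (≤-trans v≤u u≤b)))
                     0≤CB)
                   zs≤0 ⟩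
            C * B * (value u - value s) + 0#
              ≡⟨ +-identityʳ _ ⟩
            C * B * (value u - value s)
              ≤⟨ *-monoʳ-≤ 0≤CB (≤-trans (+-monoˡ-≤ (- value s) u≤b) (x≤∣x∣ _)) ⟩
            C * B * ∣ value b - value s ∣
              ≡⟨ solve 3 (λ C B h → C :* B :* h := B :* (C :* h)) refl C B _ ⟩
            B * (C * ∣ value b - value s ∣) ∎
            where
            open ≤-Reasoning
            0≤CB = *-nonNegative (<⇒≤ 0<C) (<⇒≤ 0<B)

          -- For positive `B`, `improved` gives an upper bound of `S` strictly below the least one.
          B≤0 : B ≤ 0#
          B≤0 with ≤-or-> B 0#
          ... | inj₁ p   = p
          ... | inj₂ 0<B = <⇒≱
            (subst (B * (C * ∣ value b - value s ∣) <_) (*-identityʳ B) (*-monoʳ-< 0<B C∣b-s∣<1))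
            (proj₂ (proj₂ sup) _ (improved 0<B))

      -- Vanishing of `z` propagates to the right: just after a zero by `agree-locally`, whereas by
      -- continuity a point where `z` does not vanish has no zeros nearby. `local-to-global` carries
      -- this from the left end to `s`.
      solutions-agree : (∀ i → x (left-end t) i ≡ y (left-end t) i) → ∀ s i → x s i ≡ y s i
      solutions-agree x₀≗y₀ s i =
        +-cancelʳ (- y s i) (trans (‖x‖≤0⇒x≗0 (z s) zs≤0 i) (sym (-‿inverseʳ (y s i))))
        where
        P : Rel [0, t ] 0ℓ
        P u v = ‖ z u ‖ ≤ 0# → ‖ z v ‖ ≤ 0#

        local : ∀ v → Locally v λ u → (value u ≤ value v → P u v) × (value v ≤ value u → P v u)
        local v with ≤-or-> ‖ z v ‖ 0#
        ... | inj₁ zv≤0 =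
          locally-map v (λ u p → (λ _ _ → zv≤0) , (λ v≤u _ → p v≤u)) (agree-locally v zv≤0)
        ... | inj₂ 0<zv =
          locally-map v (λ u p → (λ _ zu≤0 → <⇒≱ p (zv≤ u zu≤0)) , (λ _ zv≤0 → <⇒≱ 0<zv zv≤0))
            (differentiable⇒continuous z v (z′ v) 0<zv)
          where
          open ≤-Reasoning
          zv≤ : ∀ u → ‖ z u ‖ ≤ 0# → ‖ z v ‖ ≤ ‖ z u ⊖ z v ‖
          zv≤ u zu≤0 = begin
            ‖ z v ‖
              ≤⟨ ‖‖-triangle (z v ⊖ z u) (z u) (λ i →
                   solve 2 (λ a b → a := (a :- b) :+ b) refl (z v i) (z u i)) ⟩
            ‖ z v ⊖ z u ‖ + ‖ z u ‖
              ≤⟨ +-mono-≤ (‖⊖‖-sym (z v) (z u)) zu≤0 ⟩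
            ‖ z u ⊖ z v ‖ + 0#
              ≡⟨ +-identityʳ _ ⟩
            ‖ z u ⊖ z v ‖ ∎

        zs≤0 : ‖ z s ‖ ≤ 0#
        zs≤0 = local-to-global P (λ p q → q ∘ p) (left-end t) s (0≤value s)
          (λ v _ _ → locally-map v (λ _ p _ _ → p) (local v))
          (x≗y⇒‖x⊖y‖≤c (x (left-end t)) (y (left-end t)) ≤-refl x₀≗y₀)

    -- The clock equation

    elapsed : [0, t ] → ℝ^ 1
    elapsed u _ = value u

    elapsed-hasDerivative : ∀ s → HasDerivative t elapsed s (λ _ → 1#)
    elapsed-hasDerivative s ε 0<ε = 1# , 0<1 , λ u _ →
      x≗y⇒‖x⊖y‖≤c (elapsed u ⊖ elapsed s) ((value u - value s) ⊙ (λ _ → 1#))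
        (*-nonNegative (<⇒≤ 0<ε) (0≤∣x∣ _)) λ _ → sym (*-identityʳ _)

    -- `elapsed` solves the same equation from the same initial value, so uniqueness applies.
    clock-reads-time : (x : [0, t ] → ℝ^ 1) → (∀ s → HasDerivative t x s (λ _ → 1#)) →
                       x (left-end t) zero ≡ 0# → x (right-end t) zero ≡ value t
    clock-reads-time x x′ x₀≡0 =
      solutions-agree unit-speed unit-speed-lipschitz x elapsed x′ elapsed-hasDerivative
        (λ where zero → x₀≡0) (right-end t) zero

-- Universal arrows

module CategoryReasoning {o h e} (C : Category o h e) where
  open Category C

  hom : Obj → Obj → Setoid h e
  hom A B = record { isEquivalence = equiv {A} {B} }

  module _ {A B : Obj} where
    open IsEquivalence (equiv {A} {B}) public
      using () renaming (refl to ≈-refl; sym to ≈-sym; trans to ≈-trans)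
    open SetoidReasoning (hom A B) public

module _ {o h e o′ h′ e′} {C : Category o h e} {D : Category o′ h′ e′} (R : Functor D C) where
  private
    module C where
      open Category C public
      open CategoryReasoning C public
    module D where
      open Category D public
      open CategoryReasoning D public
    module R = Functor R

  -- An initial object of the comma category of `A` over `R`; one for each `A` amounts to a left
  -- adjoint.
  record UniversalArrow (A : C.Obj) : Set (o ⊔ h ⊔ e ⊔ o′ ⊔ h′ ⊔ e′) where
    field
      obj    : D.Obj
      arrow  : C.Hom A (R.F₀ obj)
      _♯     : ∀ {X} → C.Hom A (R.F₀ X) → D.Hom obj X
      ♯-comm : ∀ {X} (f : C.Hom A (R.F₀ X)) → R.F₁ (f ♯) C.∙ arrow C.≈ f
      unique : ∀ {X} (g g′ : D.Hom obj X) → R.F₁ g C.∙ arrow C.≈ R.F₁ g′ C.∙ arrow → g D.≈ g′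

  module _ (universal : ∀ A → UniversalArrow A) where
    private
      module U {A} = UniversalArrow (universal A)

      L₀ : C.Obj → D.Obj
      L₀ A = U.obj {A}

      η : ∀ {A} → C.Hom A (R.F₀ (L₀ A))
      η = U.arrow

      L₁ : ∀ {A B} → C.Hom A B → D.Hom (L₀ A) (L₀ B)
      L₁ f = (η C.∙ f) U.♯

      ε : ∀ {X} → D.Hom (L₀ (R.F₀ X)) X
      ε = C.identity U.♯

      ∙-η : ∀ {A X Y} (g : D.Hom X Y) (h : D.Hom (L₀ A) X) {k} →
            R.F₁ h C.∙ η C.≈ k → R.F₁ (g D.∙ h) C.∙ η C.≈ R.F₁ g C.∙ k
      ∙-η g h {k} p = begin
        R.F₁ (g D.∙ h) C.∙ η        ≈⟨ C.∙-cong R.F-∙ C.≈-refl ⟩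
        (R.F₁ g C.∙ R.F₁ h) C.∙ η   ≈⟨ C.assoc ⟩
        R.F₁ g C.∙ (R.F₁ h C.∙ η)   ≈⟨ C.∙-cong C.≈-refl p ⟩
        R.F₁ g C.∙ k                ∎
        where open C

      -- Transposition expressed by the counit; counit naturality and the first triangle identity
      -- both reduce to it.
      ε-L₁ : ∀ {A X} (f : C.Hom A (R.F₀ X)) → R.F₁ (ε D.∙ L₁ f) C.∙ η C.≈ f
      ε-L₁ f = begin
        R.F₁ (ε D.∙ L₁ f) C.∙ η   ≈⟨ ∙-η ε (L₁ f) (U.♯-comm _) ⟩
        R.F₁ ε C.∙ (η C.∙ f)      ≈⟨ C.assoc ⟨
        (R.F₁ ε C.∙ η) C.∙ f      ≈⟨ C.∙-cong (U.♯-comm _) C.≈-refl ⟩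
        C.identity C.∙ f          ≈⟨ C.identityˡ ⟩
        f                         ∎
        where open C

    -- By uniqueness, each law need only be checked after applying `R` and precomposing with `η`.
    left : Functor C D
    left = record
      { F₀     = L₀
      ; F₁     = L₁
      ; F-cong = λ {_} {_} {f} {g} f≈g → U.unique _ _ (begin
          R.F₁ (L₁ f) C.∙ η   ≈⟨ U.♯-comm _ ⟩
          η C.∙ f             ≈⟨ C.∙-cong C.≈-refl f≈g ⟩
          η C.∙ g             ≈⟨ U.♯-comm _ ⟨
          R.F₁ (L₁ g) C.∙ η   ∎)
      ; F-id   = U.unique _ _ (begin
          R.F₁ (L₁ C.identity) C.∙ η   ≈⟨ U.♯-comm _ ⟩
          η C.∙ C.identity             ≈⟨ C.identityʳ ⟩
          η                            ≈⟨ C.identityˡ ⟨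
          C.identity C.∙ η             ≈⟨ C.∙-cong R.F-id C.≈-refl ⟨
          R.F₁ D.identity C.∙ η        ∎)
      ; F-∙    = λ {_} {_} {_} {g} {f} → U.unique _ _ (begin
          R.F₁ (L₁ (g C.∙ f)) C.∙ η    ≈⟨ U.♯-comm _ ⟩
          η C.∙ (g C.∙ f)              ≈⟨ C.assoc ⟨
          (η C.∙ g) C.∙ f              ≈⟨ C.∙-cong (U.♯-comm _) C.≈-refl ⟨
          (R.F₁ (L₁ g) C.∙ η) C.∙ f    ≈⟨ C.assoc ⟩
          R.F₁ (L₁ g) C.∙ (η C.∙ f)    ≈⟨ ∙-η (L₁ g) (L₁ f) (U.♯-comm _) ⟨
          R.F₁ (L₁ g D.∙ L₁ f) C.∙ η   ∎)
      }
      where open C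

    adjunction : Adjunction left R
    adjunction = record
      { unit           = λ _ → η
      ; unit-natural   = λ f → C.≈-sym (U.♯-comm _)
      ; counit         = λ _ → ε
      ; counit-natural = λ g → U.unique _ _ (begin
          R.F₁ (ε D.∙ L₁ (R.F₁ g)) C.∙ η   ≈⟨ ε-L₁ (R.F₁ g) ⟩
          R.F₁ g                           ≈⟨ C.identityʳ ⟨
          R.F₁ g C.∙ C.identity            ≈⟨ ∙-η g ε (U.♯-comm _) ⟨
          R.F₁ (g D.∙ ε) C.∙ η             ∎)
      ; triangleˡ      = λ A → U.unique _ _ (begin
          R.F₁ (ε D.∙ L₁ η) C.∙ η   ≈⟨ ε-L₁ η ⟩
          η                         ≈⟨ C.identityˡ ⟨
          C.identity C.∙ η          ≈⟨ C.∙-cong R.F-id C.≈-refl ⟨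
          R.F₁ D.identity C.∙ η     ∎)
      ; triangleʳ      = λ X → U.♯-comm _
      }
      where open C

    module _ (η⁻¹ : ∀ A → C.Hom (R.F₀ (L₀ A)) A)
             (η⁻¹∙η : ∀ A → η⁻¹ A C.∙ η C.≈ C.identity)
             (η∙η⁻¹ : ∀ A → η C.∙ η⁻¹ A C.≈ C.identity)
      where

      -- `L₁` is composition with `η` followed by transposition; the latter is always bijective, the
      -- former because `η` is invertible.
      coreflection : Coreflection R
      coreflection = record
        { left          = left
        ; adjunction    = adjunction
        ; fullyFaithful = λ A B → L-injective , λ g →
              η⁻¹ B C.∙ (R.F₁ g C.∙ η)
            , λ p → D.≈-trans (Functor.F-cong left p) (L-surjective g)
        }
        where
        L-injective : ∀ {A B} {f g : C.Hom A B} → L₁ f D.≈ L₁ g → f C.≈ g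
        L-injective {A} {B} {f} {g} p = begin
          f                           ≈⟨ cancel f ⟨
          η⁻¹ B C.∙ (η C.∙ f)         ≈⟨ C.∙-cong C.≈-refl (U.♯-comm _) ⟨
          η⁻¹ B C.∙ (R.F₁ (L₁ f) C.∙ η) ≈⟨ C.∙-cong C.≈-refl (C.∙-cong (R.F-cong p) C.≈-refl) ⟩
          η⁻¹ B C.∙ (R.F₁ (L₁ g) C.∙ η) ≈⟨ C.∙-cong C.≈-refl (U.♯-comm _) ⟩
          η⁻¹ B C.∙ (η C.∙ g)         ≈⟨ cancel g ⟩
          g                           ∎
          where
          open C
          cancel : ∀ f → η⁻¹ B C.∙ (η C.∙ f) C.≈ f
          cancel f = begin
            η⁻¹ B C.∙ (η C.∙ f)   ≈⟨ C.assoc ⟨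
            (η⁻¹ B C.∙ η) C.∙ f   ≈⟨ C.∙-cong (η⁻¹∙η B) C.≈-refl ⟩
            C.identity C.∙ f      ≈⟨ C.identityˡ ⟩
            f                     ∎

        L-surjective : ∀ {A B} (g : D.Hom (L₀ A) (L₀ B)) → L₁ (η⁻¹ B C.∙ (R.F₁ g C.∙ η)) D.≈ g
        L-surjective {A} {B} g = U.unique _ _ (begin
          R.F₁ (L₁ (η⁻¹ B C.∙ (R.F₁ g C.∙ η))) C.∙ η ≈⟨ U.♯-comm _ ⟩
          η C.∙ (η⁻¹ B C.∙ (R.F₁ g C.∙ η))           ≈⟨ C.assoc ⟨
          (η C.∙ η⁻¹ B) C.∙ (R.F₁ g C.∙ η)           ≈⟨ C.∙-cong (η∙η⁻¹ B) C.≈-refl ⟩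
          C.identity C.∙ (R.F₁ g C.∙ η)              ≈⟨ C.identityˡ ⟩
          R.F₁ g C.∙ η                               ∎)
          where open C

-- Synchronization trees and hybrid systems

module Trees (em : ExcludedMiddle 0ℓ) (ext : Extensionality 0ℓ 0ℓ)
  (R : CompleteOrderedField) (O : PseudometricSpace R) (A : Set) where
  open HybridSystems em ext R O
  open TSMorphism

  module _ {T : TransitionSystem A} where
    open TransitionSystem T

    Extends⇒Δ : ∀ {r a r⁺} → Extends T r a r⁺ → Δ (last T r) a (last T r⁺)
    Extends⇒Δ (extends δ) = recompute em δ

    Extends-unique : ∀ {r r′ a r⁺ r′⁺} → Extends T r a r⁺ → Extends T r′ a r′⁺ →
                     r ≡ r′ → last T r⁺ ≡ last T r′⁺ → r⁺ ≡ r′⁺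
    Extends-unique (extends _) (extends _) = extend-cong

    -- Plays the part of the counit for `unravelling`: composing with it turns a morphism into runs
    -- of `T` into one to `T`.
    lastMorphism : TSMorphism (unravelling T) T
    lastMorphism = record { fun = last T ; pres-i = refl ; pres-Δ = Extends⇒Δ }

  module _ {S : TransitionSystem A} (tree : IsSynchronizationTree S)
    {T : TransitionSystem A} where
    open TransitionSystem S

    run : State → Run S
    run s = proj₁ (tree s)

    last-run : ∀ s → last S (run s) ≡ s
    last-run s = proj₁ (proj₂ (tree s))

    -- Extending `run s` by the transition gives a run that ends in `s′`, which by uniqueness is
    -- `run s′`.
    run-extends : ∀ {s a s′} → Δ s a s′ → Extends S (run s) a (run s′)
    run-extends {s} {a} {s′} δ =
      subst (Extends S (run s) a) (sym (proj₂ (proj₂ (tree s′)) refl))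
        (extends (subst (λ z → Δ z a s′) (sym (last-run s)) δ))

    -- The transpose against `lastMorphism`: a state is replaced by its only run, which is mapped
    -- along `f`.
    unravel : TSMorphism S T → TSMorphism S (unravelling T)
    unravel f = record
      { fun    = mapRun f ∘ run
      ; pres-i = cong (mapRun f) (proj₂ (proj₂ (tree init)) refl)
      ; pres-Δ = pres-Δ (unravelMorphism f) ∘ run-extends
      }

    last-unravel : ∀ f s → last T (fun (unravel f) s) ≡ fun f s
    last-unravel f s = trans (last-mapRun f (run s)) (cong (fun f) (last-run s))

    -- Induction along the run to `s`: both images extend the same run by the same action, so equal
    -- last states make them equal.
    last-injective : (f g : TSMorphism S (unravelling T)) →
                     (∀ s → last T (fun f s) ≡ last T (fun g s)) → ∀ s → fun f s ≡ fun g s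
    last-injective f g f≗g s = subst (λ s → fun f s ≡ fun g s) (last-run s) (along (run s))
      where
      along : ∀ r → fun f (last S r) ≡ fun g (last S r)
      along start            = trans (pres-i f) (sym (pres-i g))
      along (extend r a s δ) = recompute em
        (Extends-unique (pres-Δ f δ) (pres-Δ g δ) (along r) (f≗g s))

-- The free hybrid system on a tree

module FreeHybridSystem (em : ExcludedMiddle 0ℓ) (ext : Extensionality 0ℓ 0ℓ)
  (R : CompleteOrderedField) (O : PseudometricSpace R) (Σ : Set) where
  open CompleteOrderedField R
  open Analysis R
  open PseudometricSpace O renaming (Point to 𝒪)
  open HybridSystems em ext R O
  open OrderedField em R
  open ODE em R
  open Trees em ext R O (Σ × ℝ≥0)
  open TSMorphism

  module _ (S : TransitionSystem (Σ × ℝ≥0)) where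
    open TransitionSystem S

    -- Events of a hybrid system carry no duration, so it is quantified away here; the guard and the
    -- clock recover it.
    Timed : State → Σ → State → Set
    Timed s a s′ = ∃ λ t → Δ s (a , t) s′

    -- Bare data, kept apart from the laws in `IsCoherent`, so that equality of subsystems is
    -- equality of data. Existence of an edge enters only irrelevantly.
    record Component : Set where
      field
        dim   : ℕ
        flow  : State → ℝ → ℝ^ dim → ℝ^ dim
        reset : ∀ s a s′ → Irrelevant (Timed s a s′) → ℝ^ dim → ℝ^ dim
        state : State → ℝ^ dim
        path  : ∀ s l s′ → Irrelevant (Δ s l s′) → [0, proj₂ l ] → ℝ^ dim

    record IsCoherent (C : Component) : Set where
      open Component C
      field
        flow-cont      : ∀ s → Continuous (flow s)
        flow-lipschitz : ∀ s → LocallyLipschitz₂ (flow s)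
        solution       : ∀ {s l s′} (δ : Δ s l s′) u →
                         HasDerivative (proj₂ l) (path s l s′ [ δ ]) u
                           (flow s (value u) (path s l s′ [ δ ] u))
        initially      : ∀ {s l s′} (δ : Δ s l s′) →
                         path s l s′ [ δ ] (left-end (proj₂ l)) ≡ state s
        jump           : ∀ {s a t s′} (δ : Δ s (a , t) s′) →
                         state s′ ≡ reset s a s′ [ t , δ ] (path s (a , t) s′ [ δ ] (right-end t))

    CoherentComponent : Set
    CoherentComponent = [ C ∈ Component ∣ IsCoherent C ]

    isCoherent : (i : CoherentComponent) → IsCoherent (value i)
    isCoherent (_ , [ p ]) = recompute em p

    module Comp (i : CoherentComponent) where
      open Component (value i) public
      open IsCoherent (isCoherent i) public

    free : HybridSystem Σ
    free = record
      { Mode           = State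
      ; Subsystem      = CoherentComponent
      ; dim            = Comp.dim
      ; Event          = Timed
      ; Guard          = λ {s} {a} {s′} _ σ →
          -- The duration is chosen before `i`: one edge serves all subsystems, so the clock fixes
          -- it for the others.
          ∃ λ t → ∃ λ (δ : Irrelevant (Δ s (a , t) s′)) →
            ∀ i → σ i ≡ Comp.path i s (a , t) s′ δ (right-end t)
      ; reset          = λ {s} {a} {s′} e i → Comp.reset i s a s′ [ e ]
      ; flow           = λ s i → Comp.flow i s
      ; flow-cont      = λ s i → Comp.flow-cont i s
      ; flow-lipschitz = λ s i → Comp.flow-lipschitz i s
      ; Invariant      = λ s σ →
          ∃ λ l → ∃ λ s′ → ∃ λ (δ : Irrelevant (Δ s l s′)) → ∃ λ u →
            ∀ i → σ i ≡ Comp.path i s l s′ δ u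
      ; m₀             = init
      ; σ₀             = λ i → Comp.state i init
      ; obs            = ω ∘ proj₁
      }

    private
      Conf = configurations Σ free
      module F = HybridSystem free

    -- The unit before unravelling: all components run along a transition of `S` simultaneously.
    canonical : TSMorphism S Conf
    canonical = record
      { fun    = λ s → s , λ i → Comp.state i s
      ; pres-i = refl
      ; pres-Δ = λ {s} {l} {s′} δ → record
          { event     = proj₂ l , δ
          ; x         = λ i → Comp.path i s l s′ [ δ ]
          ; solution  = λ i → Comp.solution i δ
          ; invariant = λ u → l , s′ , [ δ ] , u , λ _ → refl
          ; initially = λ i → Comp.initially i δ
          ; finally   = proj₂ l , [ δ ] , λ _ → refl
          ; jump      = λ i → Comp.jump i δ
          }
      }

    -- Measures the time since the last jump, hence the reading `0#` in every state and after every
    -- reset.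
    clock : CoherentComponent
    clock = component , [ coherent ]
      where
      component : Component
      component = record
        { dim   = 1
        ; flow  = λ _ → unit-speed
        ; reset = λ _ _ _ _ _ _ → 0#
        ; state = λ _ _ → 0#
        ; path  = λ _ l _ _ → elapsed (proj₂ l)
        }

      coherent : IsCoherent component
      coherent = record
        { flow-cont      = λ _ → unit-speed-continuous
        ; flow-lipschitz = λ _ → unit-speed-lipschitz
        ; solution       = λ {_} {l} _ → elapsed-hasDerivative (proj₂ l)
        ; initially      = λ _ → refl
        ; jump           = λ _ → refl
        }

    module _ {s a t s′ σ′} (μ : F.Move (s , λ i → Comp.state i s) (a , t) (s′ , σ′)) where
      open F.Move μ

      -- The final reading of the clock is `t` by uniqueness of solutions, and the duration of the
      -- edge witnessing the guard by the guard itself.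
      clock-time : value t ≡ value (proj₁ finally)
      clock-time = begin
        value t                          ≡⟨ clock-reads-time t (x clock) (solution clock)
                                              (cong (λ z → z zero) (initially clock)) ⟨
        x clock (right-end t) zero   ≡⟨ cong (λ z → z zero) (proj₂ (proj₂ finally) clock) ⟩
        value (proj₁ finally)            ∎
        where open ≡-Reasoning

      Move⇒Δ : Δ s (a , t) s′
      Move⇒Δ = let t′ , [ δ ] , _ = finally in
        subst (λ t → Δ s (a , t) s′) (sym (value-injective clock-time)) (recompute em δ)

    -- The guard makes the end point that of a path along an edge of `S`, which coherence resets to
    -- the state at `s′`.
    Move-target : ∀ {c l s′ σ′} → F.Move c l (s′ , σ′) → ∀ i → σ′ i ≡ Comp.state i s′
    Move-target {s , _} {a , t} {s′} {σ′} μ i with F.Move.finally μ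
    ... | t′ , [ δ ] , eq = begin
      σ′ i
        ≡⟨ jump i ⟩
      Comp.reset i s a s′ [ event ] (x i (right-end t))
        ≡⟨ cong (Comp.reset i s a s′ [ event ]) (eq i) ⟩
      Comp.reset i s a s′ [ event ] (Comp.path i s (a , t′) s′ [ δ ] (right-end t′))
        -- The event and the edge from the guard may differ in duration, but `reset` takes them
        -- irrelevantly.
        ≡⟨ Comp.jump i (recompute em δ) ⟨
      Comp.state i s′ ∎
      where
      open F.Move μ
      open ≡-Reasoning

    last-canonical : ∀ (r : Run Conf) → last Conf r ≡ fun canonical (proj₁ (last Conf r))
    last-canonical start                     = refl
    last-canonical (extend r l (s , σ) μ) = cong (s ,_) (ext (recompute em (Move-target μ)))

    -- The inverse of the unit. By `last-canonical` each move of a run starts at a canonical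
    -- valuation, so `Move⇒Δ` applies.
    mode : TSMorphism (unravelling Conf) S
    mode = record
      { fun    = proj₁ ∘ last Conf
      ; pres-i = refl
      ; pres-Δ = λ {r} {l} {r⁺} e →
          Move⇒Δ (subst (λ c → F.Move c l (last Conf r⁺)) (last-canonical r) (Extends⇒Δ e))
      }

    -- Morphisms out of the free system

    module _ (T : HybridSystem Σ) where
      private module T = HybridSystem T

      -- What a morphism with effect `h` on canonical configurations imposes on the subsystem
      -- assigned to `i′`. It refers to `h` alone, so that different morphisms with the same effect
      -- can be compared.
      record Follows (h : State → T.Configuration) (i′ : T.Subsystem) (i : CoherentComponent)
                     : Set where
        field
          event      : ∀ {s a s′} → Timed s a s′ → T.Event (proj₁ (h s)) a (proj₁ (h s′))
          same-dim   : Comp.dim i ≡ T.dim i′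
          same-flow  : ∀ s u x → cast same-dim (Comp.flow i s u x)
                                 ≡ T.flow (proj₁ (h s)) i′ u (cast same-dim x)
          same-reset : ∀ {s a s′} (e : Timed s a s′) x →
                       cast same-dim (Comp.reset i s a s′ [ e ] x)
                       ≡ T.reset (event e) i′ (cast same-dim x)
          same-state : ∀ s → cast same-dim (Comp.state i s) ≡ proj₂ (h s) i′

      -- Flows, resets and states are read off from `T`; the paths then agree, as they solve the
      -- same equation from the same state.
      Follows-unique : ∀ {h h′ i′ i j} → h ≡ h′ → Follows h i′ i → Follows h′ i′ j → i ≡ j
      Follows-unique
        {i = i@(record { dim = n ; flow = F ; reset = R ; state = σ ; path = x } , _)}
        {j = j@(record { dim = n′ ; flow = F′ ; reset = R′ ; state = σ′ ; path = x′ } , _)}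
        refl
        record { same-dim = refl ; same-flow = f ; same-reset = r ; same-state = s }
        record { same-dim = refl ; same-flow = f′ ; same-reset = r′ ; same-state = s′ } =
        value-injective (same-component F≡F′ R≡R′ σ≡σ′)
        where
        F≡F′ : F ≡ F′
        F≡F′ = ext λ s → ext λ u → ext λ x → trans (f s u x) (sym (f′ s u x))

        -- The two `event` fields may differ, but `T.reset` takes the event irrelevantly.
        R≡R′ : R ≡ R′
        R≡R′ = ext λ s → ext λ a → ext λ s′ → ext λ where
          [ e ] → ext λ x → trans (r (recompute em e) x) (sym (r′ (recompute em e) x))

        σ≡σ′ : σ ≡ σ′
        σ≡σ′ = ext λ v → trans (s v) (sym (s′ v))

        same-component : F ≡ F′ → R ≡ R′ → σ ≡ σ′ → value i ≡ value j
        same-component refl refl refl =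
          cong (λ x → record { dim = n ; flow = F ; reset = R ; state = σ ; path = x })
            (ext λ v → ext λ l → ext λ v′ → ext λ where
              [ δ ] → ext λ u → ext (same-path v l v′ (recompute em δ) u))
          where
          same-path : ∀ v l v′ (δ : Δ v l v′) u k → x v l v′ [ δ ] u k ≡ x′ v l v′ [ δ ] u k
          same-path v l v′ δ =
            solutions-agree (proj₂ l) (F v) (Comp.flow-lipschitz i v)
              (x v l v′ [ δ ]) (x′ v l v′ [ δ ]) (Comp.solution i δ) (Comp.solution j δ)
              (λ k → cong (λ z → z k) (trans (Comp.initially i δ) (sym (Comp.initially j δ))))

      module _ (f : TSMorphism S (configurations Σ T)) where

        -- Excluded middle chooses a move that does not depend on the proof.
        move : ∀ {s l s′} → .(Δ s l s′) → T.Move (fun f s) l (fun f s′)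
        move δ = recompute em (pres-Δ f δ)

        -- The moves of `T` along `f` supply the paths, and the laws of a move are exactly those of
        -- coherence.
        pull-back : T.Subsystem → CoherentComponent
        pull-back i = component , [ coherent ]
          where
          component : Component
          component = record
            { dim   = T.dim i
            ; flow  = λ s → T.flow (proj₁ (fun f s)) i
            ; reset = λ where s a s′ [ e ] → T.reset (T.Move.event (pres-Δ f (proj₂ e))) i
            ; state = λ s → proj₂ (fun f s) i
            ; path  = λ where s l s′ [ δ ] → T.Move.x (move δ) i
            }

          coherent : IsCoherent component
          coherent = record
            { flow-cont      = λ s → T.flow-cont (proj₁ (fun f s)) i
            ; flow-lipschitz = λ s → T.flow-lipschitz (proj₁ (fun f s)) i
            ; solution       = λ δ → T.Move.solution (move δ) i
            ; initially      = λ δ → T.Move.initially (move δ) i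
            ; jump           = λ δ → T.Move.jump (move δ) i
            }

        lift : HSMorphism Σ free T
        lift = record
          { f-M       = proj₁ ∘ fun f
          ; f-I       = pull-back
          ; pres-m₀   = cong proj₁ (pres-i f)
          ; pres-E    = T.Move.event ∘ pres-Δ f ∘ proj₂
          ; pres-dim  = λ _ → refl
          ; pres-flow = λ _ _ _ _ → refl
          ; pres-R    = λ _ _ _ → refl
          ; pres-σ₀   = λ i → cong (λ c → proj₂ c i) (pres-i f)
          -- On the pulled back components, a point common to all paths of an edge is a point on the
          -- trajectory of a move of `T`.
          ; pres-Inv  = λ {s} (_ , _ , [ δ ] , u , σ≗x) →
              subst (T.Invariant (proj₁ (fun f s))) (sym (ext (σ≗x ∘ pull-back)))
                (T.Move.invariant (move δ) u)
          ; pres-G    = λ _ (_ , [ δ ] , σ≗x) →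
              subst (T.Guard (T.Move.event (move δ))) (sym (ext (σ≗x ∘ pull-back)))
                (T.Move.finally (move δ))
          }

      Follows-f-I : ∀ (g : HSMorphism Σ free T) i →
                    Follows (HSMorphism.f-C g ∘ fun canonical) i (HSMorphism.f-I g i)
      Follows-f-I g i = record
        { event      = g.pres-E
        ; same-dim   = g.pres-dim i
        ; same-flow  = λ s → g.pres-flow s i
        ; same-reset = λ e → g.pres-R e i
        ; same-state = λ _ → refl
        }
        where module g = HSMorphism g

      -- Runs of the free system end in canonical configurations, on which `lift f` acts as `f`.
      lift-bounded : IsSynchronizationTree S → ∀ f {ε} →
                     ε -BoundedTS f → _-BoundedHS_ Σ ε (lift f)
      lift-bounded tree f {ε} b r =
        subst (λ c → d (ω (proj₁ c)) (T.obs (HSMorphism.f-C (lift f) c)) ≤ ε)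
          (sym (last-canonical r))
          (tree-bounded {f = f} tree b (proj₁ (last Conf r)))

      determined : (g g′ : HSMorphism Σ free T) →
        (∀ s → HSMorphism.f-C g (fun canonical s) ≡ HSMorphism.f-C g′ (fun canonical s)) →
        (∀ s → HSMorphism.f-M g s ≡ HSMorphism.f-M g′ s) ×
        (∀ i → HSMorphism.f-I g i ≡ HSMorphism.f-I g′ i)
      determined g g′ p =
        cong proj₁ ∘ p , λ i → Follows-unique (ext p) (Follows-f-I g i) (Follows-f-I g′ i)

  -- The universal property and the inverse of the unit

  module _ {S : TransitionSystem (Σ × ℝ≥0)} (tree : IsSynchronizationTree S) where
    open TransitionSystem S using (ω)

    private
      Conf = configurations Σ (free S)

    unitMorphism : TSMorphism S (unravelling Conf)
    unitMorphism = unravel tree (canonical S)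

    last-unit : ∀ s → last Conf (fun unitMorphism s) ≡ fun (canonical S) s
    last-unit = last-unravel tree (canonical S)

    unit-bounded : 0# -BoundedTS unitMorphism
    unit-bounded r = ≤-reflexive (trans (cong (d (ω s) ∘ ω ∘ proj₁) (last-unit s)) (d-refl (ω s)))
      where s = last S r

    -- Reduces equations between runs after the unit to equations at canonical configurations.
    last-lift : ∀ {T} (g : HSMorphism Σ (free S) T) s →
                last (configurations Σ T) (mapRun (K-morphism Σ g) (fun unitMorphism s))
                ≡ HSMorphism.f-C g (fun (canonical S) s)
    last-lift g s =
      trans (last-mapRun (K-morphism Σ g) (fun unitMorphism s))
        (cong (HSMorphism.f-C g) (last-unit s))

    universal : UniversalArrow (H Σ) (S , tree)
    universal = record
      { obj    = free S
      ; arrow  = record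
          { morphism = unitMorphism
          ; bounded  = 0# , ≤-refl , unit-bounded
          }
      ; _♯     = λ {T} f → record
          { morphism = transpose T f
          ; bounded  = let ε , 0≤ε , b = bounded f in
              ε , 0≤ε , lift-bounded S T tree (lastMorphism ∙TS morphism f) b
          }
      ; ♯-comm = λ {T} f →
          last-injective tree (unravelMorphism (K-morphism Σ (transpose T f)) ∙TS unitMorphism)
            (morphism f) (last-lift (transpose T f))
      ; unique = λ {T} g g′ p →
          determined S T (BoundedHSMorphism.morphism g) (BoundedHSMorphism.morphism g′) λ s →
            trans (sym (last-lift (BoundedHSMorphism.morphism g) s))
              (trans (cong (last (configurations Σ T)) (p s))
                (last-lift (BoundedHSMorphism.morphism g′) s))
      }
      where
      open BoundedTSMorphism using (morphism; bounded)

      transpose : ∀ T → BoundedTSMorphism S (unravelling (configurations Σ T)) →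
                  HSMorphism Σ (free S) T
      transpose T f = lift S T (lastMorphism ∙TS morphism f)

    unit⁻¹ : BoundedTSMorphism (unravelling Conf) S
    unit⁻¹ = record
      { morphism = mode S
      ; bounded  = 0# , ≤-refl , λ _ → ≤-reflexive (d-refl _)
      }

    unit⁻¹∘unit : ∀ s → fun (mode S) (fun unitMorphism s) ≡ s
    unit⁻¹∘unit s = cong proj₁ (last-unit s)

    -- Runs of the free system form a tree themselves, so comparing last states suffices, and these
    -- are canonical.
    unit∘unit⁻¹ : ∀ r → fun unitMorphism (fun (mode S) r) ≡ r
    unit∘unit⁻¹ = last-injective (unravelling-isTree Conf) (unitMorphism ∙TS mode S) idTS λ r →
      trans (last-unit (proj₁ (last Conf r))) (sym (last-canonical S r))

  H-coreflection : Coreflection (H Σ)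
  H-coreflection = coreflection (H Σ) (λ (_ , tree) → universal tree) (λ (_ , tree) → unit⁻¹ tree)
    (λ (_ , tree) → unit⁻¹∘unit tree) (λ (_ , tree) → unit∘unit⁻¹ tree)

  -- The counit is the lift of `last`, and a run is observed through its last state.
  counit-bounded : ∀ T →
    _-BoundedHS_ Σ 0# (BoundedHSMorphism.morphism (Coreflection.counit H-coreflection T))
  counit-bounded T =
    lift-bounded (unravelling Conf) T (unravelling-isTree Conf) (lastMorphism ∙TS idTS)
      (λ _ → ≤-reflexive (d-refl _))
    where Conf = configurations Σ T

theorem4 :
    (em : ExcludedMiddle 0ℓ) (ext : Extensionality 0ℓ 0ℓ)
    (R : CompleteOrderedField) (O : PseudometricSpace R) (Alphabet : Set) →
    let open CompleteOrderedField R using (0#)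
        open HybridSystems em ext R O
    in
    Σ[ C ∈ Coreflection (H Alphabet) ]
      (∀ T → 0# -BoundedTS BoundedTSMorphism.morphism (Coreflection.unit C T)) ×
      (∀ T → _-BoundedHS_ Alphabet 0# (BoundedHSMorphism.morphism (Coreflection.counit C T)))
theorem4 em ext R O Alphabet =
  H-coreflection , (λ (_ , tree) → unit-bounded tree) , counit-bounded
  where open FreeHybridSystem em ext R O Alphabet
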